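{- Let $\mathfrak{D}$ be one of the Dynkin types $A_n$, $B_n$, $D_3$, or $G_2$. Then the simplicial complex $\Delta_{\mathfrak{D}}$ of antichains in the root poset of type $\mathfrak{D}$ is shellable. For the Dynkin types $D_n$ with $n\geq 4$, $F_4$, $E_6$, $E_7$, and $E_8$, the simplicial complex $\Delta_{\mathfrak{D}}$ is not shellable.
   Context: Let $\mathfrak{D}$ be a crystallographic Dynkin type and $\Phi(\mathfrak{D})$ the crystallographic root system of type $\mathfrak{D}$. Identify $\mathfrak{D}$ with a set of simple roots of $\Phi(\mathfrak{D})$, let $\mathbb{N}=\{0,1,2,\ldots\}$, let $\mathbb{N}\mathfrak{D}$ denote the set of non-negative integer combinations of simple roots, and let $\Phi_+(\mathfrak{D})=\Phi(\mathfrak{D})\cap\mathbb{N}\mathfrak{D}$ be the set of positive roots. The root poset of type $\mathfrak{D}$ is $\Phi_+(\mathfrak{D})$ ordered by $\alpha\le\beta$ if and only if $\beta-\alpha\in\mathbb{N}\mathfrak{D}$. Set $\Delta_{\mathfrak{D}}=\{A\subseteq\Phi_+(\mathfrak{D}) : A\text{ is an antichain}\}$ (the empty set counts as an antichain); this is a simplicial complex on the ground set $\Phi_+(\mathfrak{D})$. Type $D_n$ (including $D_3$) refers to the root system $\{\pm e_i\pm e_j : 1\le i<j\le n\}$ in $\mathbb{R}^n$. A finite simplicial complex $\Delta$ (not necessarily pure) is shellable if there is a linear order $\prec$ on the set of its maximal (by inclusion) faces such that whenever $\sigma\prec\tau$ are maximal faces there is a maximal face $\gamma\prec\tau$ with $\sigma\cap\tau\subseteq\gamma\cap\tau=\tau\setminus\{x\}$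 for some $x\in\tau$. -}

module Defs where

open import Data.Fin as Fin using (Fin; inject₁; fromℕ; #_)
open import Data.Integer using (ℤ; +_; -_; 0ℤ; 1ℤ; _◃_) renaming (_+_ to _+ℤ_; _*_ to _*ℤ_; _-_ to _-ℤ_)
open import Data.List using (List; []; _∷_; _∷ʳ_; length; map; take; allFin)
open import Data.List.Membership.Propositional using () renaming (_∈_ to _∈ₗ_)
open import Data.List.Relation.Binary.Subset.Propositional using () renaming (_⊆_ to _⊆ₗ_)
open import Data.Nat using (ℕ; zero; suc)
open import Data.Product using (Σ; ∃-syntax; _×_; _,_)
open import Data.Sign as Sign using (Sign)
open import Data.Sum using (_⊎_)
open import Data.Vec as Vec using (Vec; []; _∷_)
open import Level using (0ℓ)
open import Relation.Binary using (Rel; IsStrictTotalOrder)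
open import Relation.Binary.PropositionalEquality using (_≡_; _≢_)
open import Relation.Unary using (Pred; _∩_; _∖_; _⊆_; _≐_; ｛_｝)

-- A finite set of vertices is given by a list of its elements; order and
-- repetitions are irrelevant.  Closure under ⊆ₗ makes being a face
-- independent of the list chosen.
record SimplicialComplex (V : Set) : Set₁ where
  field
    Face   : Pred (List V) 0ℓ
    closed : ∀ {σ τ} → τ ⊆ₗ σ → Face σ → Face τ

module _ {V : Set} (Δ : SimplicialComplex V) where
  open SimplicialComplex Δ

  IsFacet : Pred (List V) 0ℓ
  IsFacet σ = Face σ × (∀ τ → Face τ → σ ⊆ₗ τ → τ ⊆ₗ σ)

  Facet : Set
  Facet = Σ (List V) IsFacet

  elements : Facet → Pred V 0ℓ
  elements (σ , _) v = v ∈ₗ σ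

  -- Equality of facets as sets of vertices.
  _≈_ : Rel Facet 0ℓ
  σ ≈ τ = elements σ ≐ elements τ

  IsShelling : Rel Facet 0ℓ → Set
  IsShelling _≺_ =
    ∀ σ τ → σ ≺ τ →
      ∃[ γ ] ∃[ x ]
        γ ≺ τ
        × elements τ x
        × (elements σ ∩ elements τ) ⊆ (elements γ ∩ elements τ)
        × (elements γ ∩ elements τ) ≐ (elements τ ∖ ｛ x ｝)

  -- IsStrictTotalOrder _≈_ includes that _≺_ respects _≈_, so _≺_ is a
  -- linear order on the set of facets, whatever lists represent them.
  Shellable : Set₁
  Shellable = Σ (Rel Facet 0ℓ) λ _≺_ → IsStrictTotalOrder _≈_ _≺_ × IsShelling _≺_

ℤ^ : ℕ → Set
ℤ^ = Vec ℤ

infixl 6 _⊕_ _⊖_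
infixr 7 _·_

_⊕_ _⊖_ : ∀ {m} → ℤ^ m → ℤ^ m → ℤ^ m
_⊕_ = Vec.zipWith _+ℤ_
_⊖_ = Vec.zipWith _-ℤ_

_·_ : ∀ {m} → ℤ → ℤ^ m → ℤ^ m
k · v = Vec.map (k *ℤ_) v

0⃗ : ∀ {m} → ℤ^ m
0⃗ = Vec.replicate _ 0ℤ

e : ∀ {m} → Fin m → ℤ^ m
e i = 0⃗ Vec.[ i ]≔ 1ℤ

± : Sign → ℤ
± s = s ◃ 1

linComb : ∀ {m} (S : List (ℤ^ m)) → Vec ℕ (length S) → ℤ^ m
linComb []      []      = 0⃗
linComb (α ∷ S) (k ∷ c) = (+ k) · α ⊕ linComb S c

infix 4 _∈ℕ⟨_⟩

_∈ℕ⟨_⟩ : ∀ {m} → ℤ^ m → List (ℤ^ m) → Set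
v ∈ℕ⟨ S ⟩ = ∃[ c ] v ≡ linComb S c

-- A root system with a chosen set of simple roots, in coordinates in which
-- all roots are integral.  Only the data are recorded, not the axioms.
record RootSystem : Set₁ where
  field
    dim    : ℕ
    Φ      : Pred (ℤ^ dim) 0ℓ
    simple : List (ℤ^ dim)

module _ (R : RootSystem) where
  open RootSystem R

  Φ₊ : Pred (ℤ^ dim) 0ℓ
  Φ₊ = Φ ∩ (_∈ℕ⟨ simple ⟩)

  infix 4 _≤ᴿ_

  _≤ᴿ_ : Rel (ℤ^ dim) 0ℓ
  α ≤ᴿ β = β ⊖ α ∈ℕ⟨ simple ⟩

  IsAntichain : Pred (List (ℤ^ dim)) 0ℓ
  IsAntichain A = ∀ {α β} → α ∈ₗ A → β ∈ₗ A → α ≤ᴿ β → α ≡ β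

  antichains : SimplicialComplex (ℤ^ dim)
  antichains = record
    { Face   = λ A → (∀ {α} → α ∈ₗ A → Φ₊ α) × IsAntichain A
    ; closed = λ B⊆A (pos , anti) →
        (λ α∈B → pos (B⊆A α∈B)) , (λ α∈B β∈B → anti (B⊆A α∈B) (B⊆A β∈B))
    }

A : ℕ → RootSystem
A n = record
  { dim    = suc n
  ; Φ      = λ v → ∃[ i ] ∃[ j ] i ≢ j × v ≡ e i ⊖ e j
  ; simple = map (λ i → e (inject₁ i) ⊖ e (Fin.suc i)) (allFin n)
  }

-- e₁ - e₂, …, eₙ₋₁ - eₙ as vectors of length n = suc k
differences : ∀ k → List (ℤ^ (suc k))
differences k = RootSystem.simple (A k)

-- ± eᵢ ± eⱼ with i < j
±e±e : ∀ {m} → Pred (ℤ^ m) 0ℓ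
±e±e v = ∃[ i ] ∃[ j ] ∃[ s ] ∃[ t ] i Fin.< j × v ≡ ± s · e i ⊕ ± t · e j

±e : ∀ {m} → Pred (ℤ^ m) 0ℓ
±e v = ∃[ i ] ∃[ s ] v ≡ ± s · e i

B : ℕ → RootSystem
B n = record
  { dim    = n
  ; Φ      = λ v → ±e v ⊎ ±e±e v
  ; simple = simpleB n
  }
  where
  simpleB : ∀ n → List (ℤ^ n)
  simpleB zero    = []
  simpleB (suc k) = differences k ∷ʳ e (fromℕ k)

-- For n ≤ 1 the root system is empty.
D : ℕ → RootSystem
D n = record
  { dim    = n
  ; Φ      = ±e±e
  ; simple = simpleD n
  }
  where
  simpleD : ∀ n → List (ℤ^ n)
  simpleD zero          = []
  simpleD (suc zero)    = []
  simpleD (suc (suc k)) =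
    differences (suc k) ∷ʳ (e (inject₁ (fromℕ k)) ⊕ e (Fin.suc (fromℕ k)))

G₂ : RootSystem
G₂ = record
  { dim    = 3
  ; Φ      = λ v →
      (∃[ i ] ∃[ j ] i ≢ j × v ≡ e i ⊖ e j)
      ⊎ (∃[ i ] ∃[ j ] ∃[ k ] ∃[ s ] i ≢ j × j ≢ k × i ≢ k
           × v ≡ ± s · ((+ 2) · e i ⊖ e j ⊖ e k))
  ; simple = (+ 1 ∷ - + 1 ∷ + 0 ∷ [])
           ∷ (- + 2 ∷ + 1 ∷ + 1 ∷ [])
           ∷ []
  }

-- The usual coordinates for F₄ and E₈ include half-integers.  Below, all
-- coordinates in types F and E are doubled; this does not affect the order.

doubled : ∀ {m} → Pred (ℤ^ m) 0ℓ → Pred (ℤ^ m) 0ℓ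
doubled P v = ∃[ w ] P w × v ≡ (+ 2) · w

signProduct : ∀ {m} → Vec Sign m → Sign
signProduct = Vec.foldr _ Sign._*_ Sign.+

F₄ : RootSystem
F₄ = record
  { dim    = 4
  ; Φ      = λ v → doubled ±e v ⊎ doubled ±e±e v ⊎ (∃[ s ] v ≡ Vec.map ± s)
  ; simple = (+ 0 ∷ + 2 ∷ - + 2 ∷ + 0 ∷ [])
           ∷ (+ 0 ∷ + 0 ∷ + 2 ∷ - + 2 ∷ [])
           ∷ (+ 0 ∷ + 0 ∷ + 0 ∷ + 2 ∷ [])
           ∷ (+ 1 ∷ - + 1 ∷ - + 1 ∷ - + 1 ∷ [])
           ∷ []
  }

E₈ : RootSystem
E₈ = record
  { dim    = 8
  ; Φ      = λ v → doubled ±e±e v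
                   ⊎ (∃[ s ] signProduct s ≡ Sign.+ × v ≡ Vec.map ± s)
  ; simple =
      (+ 1 ∷ - + 1 ∷ - + 1 ∷ - + 1 ∷ - + 1 ∷ - + 1 ∷ - + 1 ∷ + 1 ∷ [])
    ∷ (+ 2 ∷ + 2 ∷ + 0 ∷ + 0 ∷ + 0 ∷ + 0 ∷ + 0 ∷ + 0 ∷ [])
    ∷ (- + 2 ∷ + 2 ∷ + 0 ∷ + 0 ∷ + 0 ∷ + 0 ∷ + 0 ∷ + 0 ∷ [])
    ∷ (+ 0 ∷ - + 2 ∷ + 2 ∷ + 0 ∷ + 0 ∷ + 0 ∷ + 0 ∷ + 0 ∷ [])
    ∷ (+ 0 ∷ + 0 ∷ - + 2 ∷ + 2 ∷ + 0 ∷ + 0 ∷ + 0 ∷ + 0 ∷ [])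
    ∷ (+ 0 ∷ + 0 ∷ + 0 ∷ - + 2 ∷ + 2 ∷ + 0 ∷ + 0 ∷ + 0 ∷ [])
    ∷ (+ 0 ∷ + 0 ∷ + 0 ∷ + 0 ∷ - + 2 ∷ + 2 ∷ + 0 ∷ + 0 ∷ [])
    ∷ (+ 0 ∷ + 0 ∷ + 0 ∷ + 0 ∷ + 0 ∷ - + 2 ∷ + 2 ∷ + 0 ∷ [])
    ∷ []
  }

-- E₇ consists of the roots of E₈ orthogonal to e₇ + e₈, and E₆ of those
-- also orthogonal to e₆ + e₈ (coordinates numbered from 1).
E₇ : RootSystem
E₇ = record
  { dim    = 8
  ; Φ      = λ v → RootSystem.Φ E₈ v
                   × Vec.lookup v (# 6) +ℤ Vec.lookup v (# 7) ≡ 0ℤ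
  ; simple = take 7 (RootSystem.simple E₈)
  }

E₆ : RootSystem
E₆ = record
  { dim    = 8
  ; Φ      = λ v → RootSystem.Φ E₇ v
                   × Vec.lookup v (# 5) +ℤ Vec.lookup v (# 7) ≡ 0ℤ
  ; simple = take 6 (RootSystem.simple E₈)
  }

{-# OPTIONS --safe #-}
module Submission where

-- Shellable types.  The positive roots can be written as E j ⊖ E i along a chain E 0, E 1, … whose
-- steps are simple roots, in such a way that the root order becomes containment of intervals and
-- the set U of occurring pairs (i , j) is closed under componentwise minimum.  Antichains are then
-- strict chains in ℕ × ℕ, and facets are ordered by the lexicographically first vertex on which
-- they differ.
--
-- Non-shellable types.  Passing to the link of a simple root removes that root from the set of
-- simple roots, and links inherit shellability; so D_n and E_n reduce to D₄.  For D₄ and F₄ the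
-- facets with at least three vertices fall into two families, according to the heights of their
-- roots, such that any two facets from different families are disjoint, which no shelling allows.

open import Defs
open import Data.Empty using (⊥; ⊥-elim)
open import Data.Fin as Fin using (Fin; zero; suc; #_; combine; fromℕ; fromℕ<; inject₁; toℕ)
open import Data.Fin.Induction using (spo-wellFounded)
import Data.Fin.Properties as Fin
open import Data.Integer using (ℤ; +_; -_; 0ℤ; 1ℤ; -1ℤ; +<+; +≤+; sign; _◃_; ∣_∣)
  renaming (_+_ to _+ℤ_; _*_ to _*ℤ_; _-_ to _-ℤ_; _≤_ to _≤ℤ_; _<_ to _<ℤ_; _≟_ to _≟ℤ_; _≤?_ to _≤ℤ?_; _<?_ to _<ℤ?_)
import Data.Integer.Properties as ℤ
open import Data.Integer.Solver using (module +-*-Solver)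
open import Data.List using (List; []; _∷_; _++_; _∷ʳ_; length; map; filter; take; upTo; cartesianProduct)
open import Data.List.Membership.Propositional using (_∈_; _∉_; find; lose)
open import Data.List.Membership.Propositional.Properties
  using (∈-++⁺ˡ; ∈-++⁺ʳ; ∈-++⁻; ∈-map⁺; ∈-map⁻; ∈-filter⁺; ∈-filter⁻; ∈-allFin;
         ∈-cartesianProduct⁺; ∈-cartesianProduct⁻; ∈-upTo⁺; ∈-upTo⁻)
open import Data.List.Properties using (map-tabulate; map-++)
open import Data.List.Relation.Binary.Subset.Propositional using () renaming (_⊆_ to _⊆ₗ_)
open import Data.List.Relation.Binary.Subset.Propositional.Properties using (filter-⊆)
open import Data.List.Relation.Unary.All as All using (All; []; _∷_; all?)
import Data.List.Relation.Unary.All.Properties as All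
open import Data.List.Relation.Unary.Any as Any using (Any; any?; here; there)
open import Data.Nat as ℕ using (ℕ; zero; suc; z≤n; s≤s; _+_; _∸_; _⊓_; _^_; _≤_; _<_)
import Data.Nat.Properties as ℕ
open import Data.Product using (∃; ∃₂; _×_; _,_; proj₁; proj₂)
open import Data.Product.Properties using (≡-dec)
open import Data.Sign as Sign using (Sign)
import Data.Sign.Properties as Sign
open import Data.Sum using (_⊎_; inj₁; inj₂; [_,_]′)
open import Data.Unit using (⊤; tt)
open import Data.Vec as Vec using (Vec; []; _∷_)
import Data.Vec.Properties as Vec
open import Data.Vec.Relation.Binary.Pointwise.Inductive as PW using (Pointwise; []; _∷_)
open import Function using (_∘_; id; _on_)
open import Induction.WellFounded using (WellFounded; Acc; acc; module Subrelation)
open import Level using (0ℓ)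
open import Relation.Binary using (Rel; DecidableEquality; IsStrictPartialOrder; IsStrictTotalOrder;
                                   Tri; tri<; tri≈; tri>)
  renaming (Decidable to Decidable₂)
import Relation.Binary.Construct.On as On
open import Relation.Binary.PropositionalEquality
open import Relation.Nullary using (¬_; Dec; yes; no; _×-dec_; _⊎-dec_; _→-dec_; ¬?; contradiction)
open import Relation.Nullary.Decidable using (True; toWitness; from-yes; map′; decidable-stable)
open import Relation.Unary using (Pred; Decidable)

open +-*-Solver using (solve; con; _:=_; _:+_; _:*_; _:-_; :-_)

-- Links

module _ {V : Set} (Δ : SimplicialComplex V) where

  Vertex : Pred V 0ℓ
  Vertex v = SimplicialComplex.Face Δ (v ∷ [])

record IsLink {V V′ : Set} (Δ : SimplicialComplex V) (Δ′ : SimplicialComplex V′)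
              (ρ : List V) (ι : V′ → V) : Set where
  open SimplicialComplex
  field
    face⁺     : ∀ {σ} → Face Δ′ σ → Face Δ (ρ ++ map ι σ)
    face⁻     : ∀ {σ} → (∀ {v} → v ∈ σ → Vertex Δ′ v) → Face Δ (ρ ++ map ι σ) → Face Δ′ σ
    covers    : ∀ {v} → Face Δ (ρ ++ v ∷ []) → v ∈ ρ ⊎ (∃ λ v′ → Vertex Δ′ v′ × v ≡ ι v′)
    injective : ∀ {u v} → Vertex Δ′ u → Vertex Δ′ v → ι u ≡ ι v → u ≡ v
    fresh     : ∀ {v} → Vertex Δ′ v → ι v ∉ ρ

module _ {V V′ : Set} {Δ : SimplicialComplex V} {Δ′ : SimplicialComplex V′}
         {ρ : List V} {ι : V′ → V} (link : IsLink Δ Δ′ ρ ι) where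
  open SimplicialComplex
  open IsLink link

  private
    vertex : ∀ {σ v} → Face Δ′ σ → v ∈ σ → Vertex Δ′ v
    vertex fσ v∈σ = closed Δ′ (λ { (here refl) → v∈σ }) fσ

    ρ∪-⊆ : ∀ {τ σ} → ρ ⊆ₗ τ → (∀ {v} → v ∈ σ → ι v ∈ τ) → ρ ++ map ι σ ⊆ₗ τ
    ρ∪-⊆ {σ = σ} ρ⊆τ ισ⊆τ p∈ with ∈-++⁻ ρ p∈
    ... | inj₁ p∈ρ = ρ⊆τ p∈ρ
    ... | inj₂ p∈ισ with ∈-map⁻ ι p∈ισ
    ... | v , v∈σ , refl = ισ⊆τ v∈σ

    ∈-image : ∀ {σ v} → Face Δ′ σ → Vertex Δ′ v → ι v ∈ ρ ++ map ι σ → v ∈ σ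
    ∈-image fσ fv p∈ with ∈-++⁻ ρ p∈
    ... | inj₁ p∈ρ = ⊥-elim (fresh fv p∈ρ)
    ... | inj₂ p∈ισ with ∈-map⁻ ι p∈ισ
    ... | u , u∈σ , eq rewrite injective fv (vertex fσ u∈σ) eq = u∈σ

    image-∈ : ∀ {σ v} → v ∈ σ → ι v ∈ ρ ++ map ι σ
    image-∈ = ∈-++⁺ʳ ρ ∘ ∈-map⁺ ι

    covers-face : ∀ {τ} → Face Δ τ → ρ ⊆ₗ τ → ∀ {v} → v ∈ τ →
                  v ∈ ρ ⊎ (∃ λ v′ → Vertex Δ′ v′ × v ≡ ι v′)
    covers-face fτ ρ⊆τ v∈τ = covers (closed Δ (λ p∈ →
      [ ρ⊆τ , (λ { (here refl) → v∈τ }) ]′ (∈-++⁻ ρ p∈)) fτ)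

    join : Facet Δ′ → Facet Δ
    join (σ , fσ , max) = ρ ++ map ι σ , face⁺ fσ , maximal
      where
      maximal : ∀ τ → Face Δ τ → ρ ++ map ι σ ⊆ₗ τ → τ ⊆ₗ ρ ++ map ι σ
      maximal τ fτ ⊆τ v∈τ with covers-face fτ (⊆τ ∘ ∈-++⁺ˡ) v∈τ
      ... | inj₁ v∈ρ = ∈-++⁺ˡ v∈ρ
      ... | inj₂ (v , fv , refl) =
        image-∈ (max (v ∷ σ) (face⁻ vertices (closed Δ (ρ∪-⊆ (⊆τ ∘ ∈-++⁺ˡ) in-τ) fτ)) there (here refl))
        where
        vertices : ∀ {u} → u ∈ v ∷ σ → Vertex Δ′ u
        vertices (here refl)  = fv
        vertices (there u∈σ) = vertex fσ u∈σ
        in-τ : ∀ {u} → u ∈ v ∷ σ → ι u ∈ τ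
        in-τ (here refl)  = v∈τ
        in-τ (there u∈σ) = ⊆τ (image-∈ u∈σ)

    preimage : ∀ τ → (∀ {v} → v ∈ τ → v ∈ ρ ⊎ (∃ λ v′ → Vertex Δ′ v′ × v ≡ ι v′)) →
               ∃ λ σ → (∀ {v} → v ∈ σ → Vertex Δ′ v × ι v ∈ τ)
                     × (∀ {v} → v ∈ τ → v ∈ ρ ⊎ (∃ λ v′ → v′ ∈ σ × v ≡ ι v′))
    preimage []      _   = [] , (λ ()) , (λ ())
    preimage (v ∷ τ) cov with preimage τ (cov ∘ there) | cov (here refl)
    ... | σ , fwd , bwd | inj₁ v∈ρ =
      σ , (λ u∈σ → let fu , u∈ = fwd u∈σ in fu , there u∈)
        , λ { (here refl) → inj₁ v∈ρ ; (there u∈τ) → bwd u∈τ }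
    ... | σ , fwd , bwd | inj₂ (v′ , fv′ , refl) =
      v′ ∷ σ
        , (λ { (here refl) → fv′ , here refl
             ; (there u∈σ) → let fu , u∈ = fwd u∈σ in fu , there u∈ })
        , λ { (here refl) → inj₂ (v′ , here refl , refl)
            ; (there u∈τ) → [ inj₁ , (λ (u , u∈σ , eq) → inj₂ (u , there u∈σ , eq)) ]′ (bwd u∈τ) }

    split : (γ : Facet Δ) → ρ ⊆ₗ proj₁ γ → ∃ λ γ′ → _≈_ Δ γ (join γ′)
    split (γ , fγ , max) ρ⊆γ with preimage γ (covers-face fγ ρ⊆γ)
    ... | σ , fwd , bwd = (σ , fσ , maximal) , (⊆-join , join-⊆)
      where
      join-⊆ : ρ ++ map ι σ ⊆ₗ γ
      join-⊆ = ρ∪-⊆ ρ⊆γ (proj₂ ∘ fwd)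
      fσ : Face Δ′ σ
      fσ = face⁻ (proj₁ ∘ fwd) (closed Δ join-⊆ fγ)
      ⊆-join : γ ⊆ₗ ρ ++ map ι σ
      ⊆-join v∈γ with bwd v∈γ
      ... | inj₁ v∈ρ = ∈-++⁺ˡ v∈ρ
      ... | inj₂ (u , u∈σ , refl) = image-∈ u∈σ
      maximal : ∀ τ → Face Δ′ τ → σ ⊆ₗ τ → τ ⊆ₗ σ
      maximal τ fτ σ⊆τ v∈τ = ∈-image fσ (vertex fτ v∈τ)
        (⊆-join (max _ (face⁺ fτ) γ⊆ (image-∈ v∈τ)))
        where
        γ⊆ : γ ⊆ₗ ρ ++ map ι τ
        γ⊆ u∈γ with bwd u∈γ
        ... | inj₁ u∈ρ = ∈-++⁺ˡ u∈ρ
        ... | inj₂ (u , u∈σ , refl) = image-∈ (σ⊆τ u∈σ)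

    join-cong : ∀ {σ τ} → _≈_ Δ′ σ τ → _≈_ Δ (join σ) (join τ)
    join-cong (σ⊆τ , τ⊆σ) = ρ∪-⊆ ∈-++⁺ˡ (image-∈ ∘ σ⊆τ) , ρ∪-⊆ ∈-++⁺ˡ (image-∈ ∘ τ⊆σ)

    join-injective : ∀ {σ τ} → _≈_ Δ (join σ) (join τ) → _≈_ Δ′ σ τ
    join-injective {_ , fσ , _} {_ , fτ , _} (σ⊆τ , τ⊆σ) =
        (λ v∈σ → ∈-image fτ (vertex fσ v∈σ) (σ⊆τ (image-∈ v∈σ)))
      , (λ v∈τ → ∈-image fσ (vertex fτ v∈τ) (τ⊆σ (image-∈ v∈τ)))

  link-shellable : Shellable Δ → Shellable Δ′
  link-shellable (_≺_ , sto , shelling) = (_≺_ on join) , sto′ , shelling′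
    where
    module O = IsStrictTotalOrder sto
    sto′ : IsStrictTotalOrder (_≈_ Δ′) (_≺_ on join)
    sto′ = record
      { isStrictPartialOrder = record
        { isEquivalence = record
          { refl  = id , id
          ; sym   = λ (p , q) → q , p
          ; trans = λ (p , q) (r , s) → r ∘ p , q ∘ s }
        ; irrefl = λ {σ} {τ} σ≈τ → O.irrefl (join-cong {σ} {τ} σ≈τ)
        ; trans = O.trans
        ; <-resp-≈ =
            (λ {υ} {σ} {τ} σ≈τ → proj₁ O.<-resp-≈ (join-cong {σ} {τ} σ≈τ))
          , (λ {υ} {σ} {τ} σ≈τ → proj₂ O.<-resp-≈ (join-cong {σ} {τ} σ≈τ)) }
      ; compare = cmp }
      where
      cmp : ∀ σ τ → Tri ((_≺_ on join) σ τ) (_≈_ Δ′ σ τ) ((_≺_ on join) τ σ)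
      cmp σ τ with O.compare (join σ) (join τ)
      ... | tri< a ¬b ¬c = tri< a (¬b ∘ join-cong {σ} {τ}) ¬c
      ... | tri≈ ¬a b ¬c = tri≈ ¬a (join-injective {σ} {τ} b) ¬c
      ... | tri> ¬a ¬b c = tri> ¬a (¬b ∘ join-cong {σ} {τ}) c
    shelling′ : IsShelling Δ′ (_≺_ on join)
    shelling′ σ τ σ≺τ with shelling (join σ) (join τ) σ≺τ
    ... | γ , x , γ≺τ , x∈τ , σ∩τ⊆γ , γ∩τ⊆τ∖x , τ∖x⊆γ∩τ
      with (λ {v} v∈ρ → proj₁ (σ∩τ⊆γ {v} (∈-++⁺ˡ v∈ρ , ∈-++⁺ˡ v∈ρ))) | ∈-++⁻ ρ x∈τ
    ... | ρ⊆γ | inj₁ x∈ρ = ⊥-elim (proj₂ (γ∩τ⊆τ∖x (ρ⊆γ x∈ρ , x∈τ)) refl)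
    ... | ρ⊆γ | inj₂ x∈ιτ with ∈-map⁻ ι x∈ιτ | split γ ρ⊆γ
    ... | x′ , x′∈τ , refl | γ′ , γ≈ =
      γ′ , x′ , proj₂ O.<-resp-≈ γ≈ γ≺τ , x′∈τ
      , (λ (v∈σ , v∈τ) → ∈γ′ v∈τ (proj₁ (σ∩τ⊆γ (image-∈ v∈σ , image-∈ v∈τ))) , v∈τ)
      , (λ (v∈γ , v∈τ) → v∈τ , λ { refl → proj₂ (γ∩τ⊆τ∖x (proj₂ γ≈ (image-∈ v∈γ) , image-∈ v∈τ)) refl })
      , (λ (v∈τ , x≢v) → ∈γ′ v∈τ (proj₁ (τ∖x⊆γ∩τ (image-∈ v∈τ ,
           λ eq → x≢v (injective (vertex (proj₁ (proj₂ τ)) x′∈τ) (vertex (proj₁ (proj₂ τ)) v∈τ) eq)))) , v∈τ)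
      where
      ∈γ′ : ∀ {v} → v ∈ proj₁ τ → ι v ∈ proj₁ γ → v ∈ proj₁ γ′
      ∈γ′ v∈τ ιv∈γ = ∈-image (proj₁ (proj₂ γ′)) (vertex (proj₁ (proj₂ τ)) v∈τ) (proj₁ γ≈ ιv∈γ)

module _ {V : Set} (P : Pred V 0ℓ) (_≤_ : Rel V 0ℓ) where

  antichainComplex : SimplicialComplex V
  antichainComplex = record
    { Face   = λ A → (∀ {α} → α ∈ A → P α)
                     × (∀ {α β} → α ∈ A → β ∈ A → α ≤ β → α ≡ β)
    ; closed = λ B⊆A (pos , anti) →
        (λ α∈B → pos (B⊆A α∈B)) , (λ α∈B β∈B → anti (B⊆A α∈B) (B⊆A β∈B))
    }

record IsPosetLink {V V′ : Set} (P : Pred V 0ℓ) (_≤_ : Rel V 0ℓ) (P′ : Pred V′ 0ℓ) (_≤′_ : Rel V′ 0ℓ)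
                   (ρ : List V) (ι : V′ → V) : Set where
  field
    refl-≤       : ∀ {α} → P α → α ≤ α
    base         : SimplicialComplex.Face (antichainComplex P _≤_) ρ
    into         : ∀ {v} → P′ v → P (ι v)
    mono         : ∀ {u v} → P′ u → P′ v → u ≤′ v → ι u ≤ ι v
    reflect      : ∀ {u v} → P′ u → P′ v → ι u ≤ ι v → u ≤′ v
    injective    : ∀ {u v} → P′ u → P′ v → ι u ≡ ι v → u ≡ v
    incomparable : ∀ {α v} → α ∈ ρ → P′ v → ¬ (α ≤ ι v) × ¬ (ι v ≤ α)
    covers       : ∀ {v} → P v → (∀ {α} → α ∈ ρ → α ≤ v → α ≡ v) →
                   v ∈ ρ ⊎ (∃ λ v′ → P′ v′ × v ≡ ι v′)

module _ {V V′ : Set} {P : Pred V 0ℓ} {_≤_ : Rel V 0ℓ} {P′ : Pred V′ 0ℓ} {_≤′_ : Rel V′ 0ℓ}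
         {ρ : List V} {ι : V′ → V} (poset-link : IsPosetLink P _≤_ P′ _≤′_ ρ ι) where
  open IsPosetLink poset-link
  private
    Δ  = antichainComplex P _≤_
    Δ′ = antichainComplex P′ _≤′_
  open SimplicialComplex

  isLink : IsLink Δ Δ′ ρ ι
  isLink = record
    { face⁺     = face⁺
    ; face⁻     = λ verts (pos , anti) →
        (λ v∈σ → proj₁ (verts v∈σ) (here refl))
      , λ u∈σ v∈σ u≤v → let pu = proj₁ (verts u∈σ) (here refl) ; pv = proj₁ (verts v∈σ) (here refl) in
          injective pu pv (anti (∈-++⁺ʳ ρ (∈-map⁺ ι u∈σ)) (∈-++⁺ʳ ρ (∈-map⁺ ι v∈σ)) (mono pu pv u≤v))
    ; covers    = λ {v} (pos , anti) →
        [ inj₁ , (λ (v′ , pv′ , eq) → inj₂ (v′ , vertex pv′ , eq)) ]′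
          (covers (pos (∈-++⁺ʳ ρ (here refl))) (λ α∈ρ → anti (∈-++⁺ˡ α∈ρ) (∈-++⁺ʳ ρ (here refl))))
    ; injective = λ (pu , _) (pv , _) → injective (pu (here refl)) (pv (here refl))
    ; fresh     = λ (pv , _) ιv∈ρ → proj₁ (incomparable ιv∈ρ (pv (here refl))) (refl-≤ (into (pv (here refl))))
    }
    where
    vertex : ∀ {v} → P′ v → Vertex Δ′ v
    vertex pv = (λ { (here refl) → pv }) , λ { (here refl) (here refl) _ → refl }
    face⁺ : ∀ {σ} → Face Δ′ σ → Face Δ (ρ ++ map ι σ)
    face⁺ {σ} (pos , anti) = pos⁺ , anti⁺
      where
      pos⁺ : ∀ {α} → α ∈ ρ ++ map ι σ → P α
      pos⁺ α∈ with ∈-++⁻ ρ α∈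
      ... | inj₁ α∈ρ = proj₁ base α∈ρ
      ... | inj₂ α∈ισ with ∈-map⁻ ι α∈ισ
      ... | v , v∈σ , refl = into (pos v∈σ)
      anti⁺ : ∀ {α β} → α ∈ ρ ++ map ι σ → β ∈ ρ ++ map ι σ → α ≤ β → α ≡ β
      anti⁺ α∈ β∈ α≤β with ∈-++⁻ ρ α∈ | ∈-++⁻ ρ β∈
      ... | inj₁ α∈ρ  | inj₁ β∈ρ = proj₂ base α∈ρ β∈ρ α≤β
      ... | inj₁ α∈ρ  | inj₂ β∈ισ with ∈-map⁻ ι β∈ισ
      ... | v , v∈σ , refl = ⊥-elim (proj₁ (incomparable α∈ρ (pos v∈σ)) α≤β)
      anti⁺ α∈ β∈ α≤β | inj₂ α∈ισ | inj₁ β∈ρ with ∈-map⁻ ι α∈ισ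
      ... | v , v∈σ , refl = ⊥-elim (proj₂ (incomparable β∈ρ (pos v∈σ)) α≤β)
      anti⁺ α∈ β∈ α≤β | inj₂ α∈ισ | inj₂ β∈ισ with ∈-map⁻ ι α∈ισ | ∈-map⁻ ι β∈ισ
      ... | u , u∈σ , refl | v , v∈σ , refl =
        cong ι (anti u∈σ v∈σ (reflect (pos u∈σ) (pos v∈σ) α≤β))

-- Finite antichain complexes

module FiniteAntichains {V : Set} (_≟_ : DecidableEquality V) (U : List V)
                        {_≤_ : Rel V 0ℓ} (_≤?_ : Decidable₂ _≤_) where

  Δ : SimplicialComplex V
  Δ = antichainComplex (_∈ U) _≤_

  open SimplicialComplex Δ

  Compatible : Rel V 0ℓ
  Compatible p q = (p ≤ q → p ≡ q) × (q ≤ p → p ≡ q)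

  compatible? : Decidable₂ Compatible
  compatible? p q = (p ≤? q →-dec p ≟ q) ×-dec (q ≤? p →-dec p ≟ q)

  insert : ∀ {σ p} → Face σ → p ∈ U → (∀ {q} → q ∈ σ → Compatible p q) → Face (p ∷ σ)
  insert {σ} {p} (pos , anti) p∈U comp = pos′ , anti′
    where
    pos′ : ∀ {q} → q ∈ p ∷ σ → q ∈ U
    pos′ (here refl) = p∈U
    pos′ (there q∈) = pos q∈
    anti′ : ∀ {q r} → q ∈ p ∷ σ → r ∈ p ∷ σ → q ≤ r → q ≡ r
    anti′ (here refl) (here refl) _   = refl
    anti′ (here refl) (there r∈)  q≤r = proj₁ (comp r∈) q≤r
    anti′ (there q∈)  (here refl) q≤r = sym (proj₂ (comp q∈) q≤r)
    anti′ (there q∈)  (there r∈)  q≤r = anti q∈ r∈ q≤r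

  extend : ∀ L {σ} → Face σ → (∀ {p} → p ∈ L → p ∈ U) →
           ∃ λ γ → Face γ × σ ⊆ₗ γ × (∀ {p} → p ∈ L → (∀ {q} → q ∈ γ → Compatible p q) → p ∈ γ)
  extend []      fσ L⊆U = _ , fσ , id , λ ()
  extend (p ∷ L) {σ} fσ L⊆U with all? (compatible? p) σ
  ... | yes comp with extend L (insert fσ (L⊆U (here refl)) (All.lookup comp)) (L⊆U ∘ there)
  ...   | γ , fγ , σ⊆γ , sat =
    γ , fγ , σ⊆γ ∘ there , λ { (here refl) _ → σ⊆γ (here refl) ; (there q∈) → sat q∈ }
  extend (p ∷ L) {σ} fσ L⊆U | no ¬comp with extend L fσ (L⊆U ∘ there)
  ...   | γ , fγ , σ⊆γ , sat =
    γ , fγ , σ⊆γ , λ { (here refl) comp → ⊥-elim (¬comp (All.tabulate (comp ∘ σ⊆γ))) ; (there q∈) → sat q∈ }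

  extend-facet : ∀ {σ} → Face σ → ∃ λ (γ : Facet Δ) → σ ⊆ₗ proj₁ γ
  extend-facet fσ with extend U fσ id
  ... | γ , fγ , σ⊆γ , sat = (γ , fγ , λ τ (pos , anti) γ⊆τ p∈τ →
      sat (pos p∈τ) λ q∈γ → anti p∈τ (γ⊆τ q∈γ) , sym ∘ anti (γ⊆τ q∈γ) p∈τ) , σ⊆γ

  facet-absorbs : ∀ (τ : Facet Δ) {p} → p ∈ U → (∀ {q} → q ∈ proj₁ τ → Compatible p q) → p ∈ proj₁ τ
  facet-absorbs (τ , fτ , max) p∈U comp = max _ (insert fτ p∈U comp) there (here refl)

-- Planar posets

ℕ² : Set
ℕ² = ℕ × ℕ

infix 4 _⊑_ _≪_ _<ₗ_

-- The pair (i , j) stands for the interval from i to j, and ⊑ for containment.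
_⊑_ _≪_ _<ₗ_ : Rel ℕ² 0ℓ
(i , j) ⊑ (k , l)  = k ≤ i × j ≤ l
(i , j) ≪ (k , l)  = i < k × j < l
(i , j) <ₗ (k , l) = i < k ⊎ i ≡ k × j < l

_∧_ : ℕ² → ℕ² → ℕ²
(i , j) ∧ (k , l) = i ⊓ k , j ⊓ l

_⊑?_ : Decidable₂ _⊑_
(i , j) ⊑? (k , l) = (k ℕ.≤? i) ×-dec (j ℕ.≤? l)

_≟²_ : DecidableEquality ℕ²
_≟²_ = ≡-dec ℕ._≟_ ℕ._≟_

open import Data.List.Membership.DecPropositional _≟²_ using () renaming (_∈?_ to infix 4 _∈²?_)

<ₗ-trans : ∀ {p q r} → p <ₗ q → q <ₗ r → p <ₗ r
<ₗ-trans (inj₁ a)          (inj₁ b)          = inj₁ (ℕ.<-trans a b)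
<ₗ-trans (inj₁ a)          (inj₂ (refl , _)) = inj₁ a
<ₗ-trans (inj₂ (refl , _)) (inj₁ b)          = inj₁ b
<ₗ-trans (inj₂ (refl , a)) (inj₂ (refl , b)) = inj₂ (refl , ℕ.<-trans a b)

<ₗ-irrefl : ∀ {p} → ¬ (p <ₗ p)
<ₗ-irrefl (inj₁ a)       = ℕ.n≮n _ a
<ₗ-irrefl (inj₂ (_ , a)) = ℕ.n≮n _ a

<ₗ-asym : ∀ {p q} → p <ₗ q → ¬ (q <ₗ p)
<ₗ-asym a b = <ₗ-irrefl (<ₗ-trans a b)

<ₗ-cmp : ∀ p q → p <ₗ q ⊎ p ≡ q ⊎ q <ₗ p
<ₗ-cmp (i , j) (k , l) with ℕ.<-cmp i k
... | tri< a _ _ = inj₁ (inj₁ a)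
... | tri> _ _ c = inj₂ (inj₂ (inj₁ c))
... | tri≈ _ refl _ with ℕ.<-cmp j l
...   | tri< a _ _    = inj₁ (inj₂ (refl , a))
...   | tri≈ _ refl _ = inj₂ (inj₁ refl)
...   | tri> _ _ c    = inj₂ (inj₂ (inj₂ (refl , c)))

≪-trans : ∀ {p q r} → p ≪ q → q ≪ r → p ≪ r
≪-trans (a , b) (c , d) = ℕ.<-trans a c , ℕ.<-trans b d

∧-≪ : ∀ {p q r} → p ≪ q → p ≪ r → p ≪ q ∧ r
∧-≪ (a , b) (c , d) = ℕ.⊓-glb a c , ℕ.⊓-glb b d

≪-∧ʳ : ∀ {p q r} → p ≪ q ∧ r → p ≪ r
≪-∧ʳ (a , b) = ℕ.<-≤-trans a (ℕ.m⊓n≤n _ _) , ℕ.<-≤-trans b (ℕ.m⊓n≤n _ _)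

∧ʳ-≪ : ∀ {p q r} → q ≪ r → p ∧ q ≪ r
∧ʳ-≪ (a , b) = ℕ.≤-<-trans (ℕ.m⊓n≤n _ _) a , ℕ.≤-<-trans (ℕ.m⊓n≤n _ _) b

⊑-antisym : ∀ {p q} → p ⊑ q → q ⊑ p → p ≡ q
⊑-antisym (a , b) (c , d) = cong₂ _,_ (ℕ.≤-antisym c a) (ℕ.≤-antisym b d)

least : {P : Pred ℕ² 0ℓ} → Decidable P → ∀ L →
        (∃ λ d → d ∈ L × P d × (∀ {p} → p ∈ L → P p → ¬ (p <ₗ d))) ⊎ (∀ {p} → p ∈ L → ¬ P p)
least P? []      = inj₂ λ ()
least P? (q ∷ L) with P? q | least P? L
... | no ¬Pq | inj₂ none = inj₂ λ { (here refl) → ¬Pq ; (there p∈) → none p∈ }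
... | no ¬Pq | inj₁ (d , d∈ , Pd , min) =
  inj₁ (d , there d∈ , Pd , λ { (here refl) Pq → contradiction Pq ¬Pq ; (there p∈) → min p∈ })
... | yes Pq | inj₂ none =
  inj₁ (q , here refl , Pq , λ { (here refl) _ → <ₗ-irrefl ; (there p∈) Pp → contradiction Pp (none p∈) })
... | yes Pq | inj₁ (d , d∈ , Pd , min) with <ₗ-cmp q d
...   | inj₁ q<d = inj₁ (q , here refl , Pq ,
          λ { (here refl) _ → <ₗ-irrefl ; (there p∈) Pp p<q → min p∈ Pp (<ₗ-trans p<q q<d) })
...   | inj₂ (inj₁ refl) = inj₁ (q , here refl , Pq ,
          λ { (here refl) _ → <ₗ-irrefl ; (there p∈) Pp p<q → min p∈ Pp p<q })
...   | inj₂ (inj₂ d<q) = inj₁ (d , there d∈ , Pd ,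
          λ { (here refl) _ → <ₗ-asym d<q ; (there p∈) Pp → min p∈ Pp })

_<ₗ?_ : Decidable₂ _<ₗ_
p <ₗ? q with <ₗ-cmp p q
... | inj₁ p<q         = yes p<q
... | inj₂ (inj₁ refl) = no <ₗ-irrefl
... | inj₂ (inj₂ q<p)  = no (<ₗ-asym q<p)

∧-<ₗ : ∀ {p q} → p <ₗ q → p ∧ q <ₗ q
∧-<ₗ {i , j} {k , l} (inj₁ i<k) = inj₁ (ℕ.≤-<-trans (ℕ.m⊓n≤m i k) i<k)
∧-<ₗ {i , j} {k , l} (inj₂ (refl , j<l)) = inj₂ (ℕ.⊓-idem i , ℕ.≤-<-trans (ℕ.m⊓n≤m j l) j<l)

∧≪⇒≪ : ∀ {p q} → p <ₗ q → p ∧ q ≪ q → p ≪ q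
∧≪⇒≪ {i , j} {k , l} (inj₁ i<k) (_ , m<l) with ℕ.⊓-sel j l
... | inj₁ eq = i<k , subst (_< l) eq m<l
... | inj₂ eq = contradiction (subst (_< l) eq m<l) (ℕ.n≮n l)
∧≪⇒≪ {i , j} {k , l} (inj₂ (refl , _)) (m<k , _) = contradiction (subst (_< i) (ℕ.⊓-idem i) m<k) (ℕ.n≮n i)

module Planar (U : List ℕ²) (∧-closed : ∀ {p q} → p ∈ U → q ∈ U → p ∧ q ∈ U) where

  open FiniteAntichains _≟²_ U _⊑?_
  open SimplicialComplex Δ

  ≪⇒compatible : ∀ {p q} → p ≪ q → Compatible p q
  ≪⇒compatible (a , b) = (λ (c , _) → ⊥-elim (ℕ.<⇒≱ a c)) , λ (_ , d) → ⊥-elim (ℕ.<⇒≱ b d)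

  ≫⇒compatible : ∀ {p q} → q ≪ p → Compatible p q
  ≫⇒compatible (a , b) = (λ (_ , d) → ⊥-elim (ℕ.<⇒≱ b d)) , λ (c , _) → ⊥-elim (ℕ.<⇒≱ a c)

  <ₗ⇒≪ : ∀ {σ p q} → Face σ → p ∈ σ → q ∈ σ → p <ₗ q → p ≪ q
  <ₗ⇒≪ {p = i , j} {k , l} (_ , anti) p∈ q∈ p<q@(inj₁ i<k) with ℕ.<-cmp j l
  ... | tri< j<l _ _ = i<k , j<l
  ... | tri≈ _ refl _ = ⊥-elim (<ₗ-irrefl (subst (_<ₗ (k , l)) (sym (anti q∈ p∈ (ℕ.<⇒≤ i<k , ℕ.≤-refl))) p<q))
  ... | tri> _ _ l<j  = ⊥-elim (<ₗ-irrefl (subst (_<ₗ (k , l)) (sym (anti q∈ p∈ (ℕ.<⇒≤ i<k , ℕ.<⇒≤ l<j))) p<q))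
  <ₗ⇒≪ {p = p} {q} (_ , anti) p∈ q∈ p<q@(inj₂ (refl , j<l)) =
    ⊥-elim (<ₗ-irrefl (subst (_<ₗ q) (anti p∈ q∈ (ℕ.≤-refl , ℕ.<⇒≤ j<l)) p<q))

  _≺_ : Rel (Facet Δ) 0ℓ
  (σ , _) ≺ (τ , _) = ∃ λ d → d ∈ σ × d ∉ τ × (∀ {p} → p <ₗ d → (p ∈ σ → p ∈ τ) × (p ∈ τ → p ∈ σ))

  ≺-trans : ∀ {σ τ υ} → σ ≺ τ → τ ≺ υ → σ ≺ υ
  ≺-trans (d , d∈σ , d∉τ , below-d) (c , c∈τ , c∉υ , below-c) with <ₗ-cmp d c
  ... | inj₁ d<c = d , d∈σ , (λ d∈υ → d∉τ (proj₂ (below-c d<c) d∈υ)) , λ p<d →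
    let f , g = below-d p<d ; h , k = below-c (<ₗ-trans p<d d<c) in h ∘ f , g ∘ k
  ... | inj₂ (inj₁ refl) = contradiction c∈τ d∉τ
  ... | inj₂ (inj₂ c<d) = c , proj₂ (below-d c<d) c∈τ , c∉υ , λ p<c →
    let f , g = below-d (<ₗ-trans p<c c<d) ; h , k = below-c p<c in h ∘ f , g ∘ k

  ≺-irrefl : ∀ {σ τ} → _≈_ Δ σ τ → ¬ (σ ≺ τ)
  ≺-irrefl (σ⊆τ , _) (_ , d∈σ , d∉τ , _) = d∉τ (σ⊆τ d∈σ)

  ≺-compare : ∀ σ τ → Tri (σ ≺ τ) (_≈_ Δ σ τ) (τ ≺ σ)
  ≺-compare 𝛔@(σ , _) 𝛕@(τ , _)
    with least (λ p → (p ∈²? σ ×-dec ¬? (p ∈²? τ)) ⊎-dec (p ∈²? τ ×-dec ¬? (p ∈²? σ))) (σ ++ τ)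
  ... | inj₂ none = tri≈ (≺-irrefl {𝛔} {𝛕} eq) eq (≺-irrefl {𝛕} {𝛔} (proj₂ eq , proj₁ eq))
    where
    eq : _≈_ Δ 𝛔 𝛕
    eq = (λ {p} p∈σ → decidable-stable (p ∈²? τ) λ p∉τ → none (∈-++⁺ˡ p∈σ) (inj₁ (p∈σ , p∉τ)))
       , (λ {p} p∈τ → decidable-stable (p ∈²? σ) λ p∉σ → none (∈-++⁺ʳ σ p∈τ) (inj₂ (p∈τ , p∉σ)))
  ... | inj₁ (d , _ , diff , min) = by-side diff
    where
    agree : ∀ {p} → p <ₗ d → (p ∈ σ → p ∈ τ) × (p ∈ τ → p ∈ σ)
    agree {p} p<d =
        (λ p∈σ → decidable-stable (p ∈²? τ) λ p∉τ → min (∈-++⁺ˡ p∈σ) (inj₁ (p∈σ , p∉τ)) p<d)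
      , (λ p∈τ → decidable-stable (p ∈²? σ) λ p∉σ → min (∈-++⁺ʳ σ p∈τ) (inj₂ (p∈τ , p∉σ)) p<d)
    by-side : (d ∈ σ × d ∉ τ) ⊎ (d ∈ τ × d ∉ σ) → Tri (𝛔 ≺ 𝛕) (_≈_ Δ 𝛔 𝛕) (𝛕 ≺ 𝛔)
    by-side (inj₁ (d∈σ , d∉τ)) =
      tri< σ≺τ (λ eq → d∉τ (proj₁ eq d∈σ)) λ τ≺σ → ≺-irrefl {𝛔} {𝛔} (id , id) (≺-trans {𝛔} {𝛕} {𝛔} σ≺τ τ≺σ)
      where
      σ≺τ : 𝛔 ≺ 𝛕
      σ≺τ = d , d∈σ , d∉τ , agree
    by-side (inj₂ (d∈τ , d∉σ)) =
      tri> (λ σ≺τ → ≺-irrefl {𝛔} {𝛔} (id , id) (≺-trans {𝛔} {𝛕} {𝛔} σ≺τ τ≺σ)) (λ eq → d∉σ (proj₂ eq d∈τ)) τ≺σ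
      where
      τ≺σ : 𝛕 ≺ 𝛔
      τ≺σ = d , d∈τ , d∉σ , (λ p<d → proj₂ (agree p<d) , proj₁ (agree p<d))

  ≺-isStrictTotalOrder : IsStrictTotalOrder (_≈_ Δ) _≺_
  ≺-isStrictTotalOrder = record
    { isStrictPartialOrder = record
      { isEquivalence = record
        { refl  = id , id
        ; sym   = λ (p , q) → q , p
        ; trans = λ (p , q) (r , s) → r ∘ p , q ∘ s }
      ; irrefl   = λ {σ} {τ} → ≺-irrefl {σ} {τ}
      ; trans    = λ {σ} {τ} {υ} → ≺-trans {σ} {τ} {υ}
      ; <-resp-≈ =
          (λ (f , g) (d , d∈ , d∉ , below) → d , d∈ , d∉ ∘ g , λ p<d →
            f ∘ proj₁ (below p<d) , proj₂ (below p<d) ∘ g)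
        , (λ (f , g) (d , d∈ , d∉ , below) → d , f d∈ , d∉ , λ p<d →
            proj₁ (below p<d) ∘ g , f ∘ proj₂ (below p<d)) }
    ; compare = ≺-compare }

  -- d is the first vertex on which σ and τ differ, t the vertex of τ after d.
  -- Since w = d ∧ t precedes d and lies below all that is above t, the face
  -- (τ ∖ t) ∪ {w} extends to a facet γ ≺ τ.
  ≺-isShelling : IsShelling Δ _≺_
  ≺-isShelling 𝛔@(σ , fσ , _) 𝛕@(τ , fτ , _) (d , d∈σ , d∉τ , below) with least (λ p → d <ₗ? p) τ
  ... | inj₂ none = contradiction (facet-absorbs 𝛕 (proj₁ fσ d∈σ) comp) d∉τ
    where
    comp : ∀ {q} → q ∈ τ → Compatible d q
    comp {q} q∈τ with <ₗ-cmp d q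
    ... | inj₁ d<q        = contradiction d<q (none q∈τ)
    ... | inj₂ (inj₁ refl) = contradiction q∈τ d∉τ
    ... | inj₂ (inj₂ q<d)  = ≫⇒compatible (<ₗ⇒≪ fσ (proj₂ (below q<d) q∈τ) d∈σ q<d)
  ... | inj₁ (t , t∈τ , d<t , t-first) = γ , t , γ≺τ , t∈τ
    , (λ (p∈σ , p∈τ) → ⊆γ p∈τ (λ { refl → t∉σ p∈σ }) , p∈τ)
    , (λ (p∈γ , p∈τ) → p∈τ , λ { refl → t∉γ p∈γ })
    , (λ (p∈τ , t≢p) → ⊆γ p∈τ (t≢p ∘ sym) , p∈τ)
    where
    w = d ∧ t

    before-d : ∀ {p} → p ∈ τ → p ≢ t → p <ₗ d ⊎ t ≪ p
    before-d {p} p∈τ p≢t with <ₗ-cmp p d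
    ... | inj₁ p<d         = inj₁ p<d
    ... | inj₂ (inj₁ refl) = contradiction p∈τ d∉τ
    ... | inj₂ (inj₂ d<p) with <ₗ-cmp t p
    ...   | inj₁ t<p         = inj₂ (<ₗ⇒≪ fτ t∈τ p∈τ t<p)
    ...   | inj₂ (inj₁ refl) = contradiction refl p≢t
    ...   | inj₂ (inj₂ p<t)  = contradiction p<t (t-first p∈τ d<p)

    ≪d : ∀ {p} → p ∈ τ → p <ₗ d → p ≪ d
    ≪d p∈τ p<d = <ₗ⇒≪ fσ (proj₂ (below p<d) p∈τ) d∈σ p<d

    d≪̸t : ¬ (d ≪ t)
    d≪̸t d≪t = d∉τ (facet-absorbs 𝛕 (proj₁ fσ d∈σ) comp)
      where
      comp : ∀ {q} → q ∈ τ → Compatible d q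
      comp {q} q∈τ with q ≟² t
      ... | yes refl = ≪⇒compatible d≪t
      ... | no q≢t with before-d q∈τ q≢t
      ...   | inj₁ q<d = ≫⇒compatible (≪d q∈τ q<d)
      ...   | inj₂ t≪q = ≪⇒compatible (≪-trans d≪t t≪q)

    t∉σ : t ∉ σ
    t∉σ t∈σ = d≪̸t (<ₗ⇒≪ fσ d∈σ t∈σ d<t)

    w≪̸t : ¬ (w ≪ t)
    w≪̸t = d≪̸t ∘ ∧≪⇒≪ d<t

    w<t : w <ₗ t
    w<t = ∧-<ₗ d<t

    τ∖t = filter (λ p → ¬? (p ≟² t)) τ

    exchanged : Face (w ∷ τ∖t)
    exchanged = insert (closed (filter-⊆ _ τ) fτ) (∧-closed (proj₁ fσ d∈σ) (proj₁ fτ t∈τ)) comp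
      where
      comp : ∀ {q} → q ∈ τ∖t → Compatible w q
      comp q∈ with ∈-filter⁻ _ {xs = τ} q∈
      ... | q∈τ , q≢t with before-d q∈τ q≢t
      ...   | inj₁ q<d = ≫⇒compatible (∧-≪ (≪d q∈τ q<d) (<ₗ⇒≪ fτ q∈τ t∈τ (<ₗ-trans q<d d<t)))
      ...   | inj₂ t≪q = ≪⇒compatible (∧ʳ-≪ t≪q)

    γ : Facet Δ
    γ = proj₁ (extend-facet exchanged)

    fγ : Face (proj₁ γ)
    fγ = proj₁ (proj₂ γ)

    w∈γ : w ∈ proj₁ γ
    w∈γ = proj₂ (extend-facet exchanged) (here refl)

    ⊆γ : ∀ {p} → p ∈ τ → p ≢ t → p ∈ proj₁ γ
    ⊆γ p∈τ p≢t = proj₂ (extend-facet exchanged) (there (∈-filter⁺ _ p∈τ p≢t))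

    t∉γ : t ∉ proj₁ γ
    t∉γ t∈γ = w≪̸t (<ₗ⇒≪ fγ w∈γ t∈γ w<t)

    w∉τ : w ∉ τ
    w∉τ w∈τ = w≪̸t (<ₗ⇒≪ fτ w∈τ t∈τ w<t)

    γ≺τ : γ ≺ 𝛕
    γ≺τ = w , w∈γ , w∉τ , λ p<w →
        (λ p∈γ → facet-absorbs 𝛕 (proj₁ fγ p∈γ) (comp p∈γ p<w))
      , (λ p∈τ → ⊆γ p∈τ λ { refl → <ₗ-asym p<w w<t })
      where
      comp : ∀ {p} → p ∈ proj₁ γ → p <ₗ w → ∀ {q} → q ∈ τ → Compatible p q
      comp p∈γ p<w {q} q∈τ with q ≟² t
      ... | yes refl = ≪⇒compatible (≪-∧ʳ (<ₗ⇒≪ fγ p∈γ w∈γ p<w))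
      ... | no q≢t   = proj₂ fγ p∈γ (⊆γ q∈τ q≢t) , sym ∘ proj₂ fγ (⊆γ q∈τ q≢t) p∈γ

  planar-shellable : Shellable Δ
  planar-shellable = _≺_ , ≺-isStrictTotalOrder , ≺-isShelling

-- An obstruction to shellability

module _ {V : Set} (_≟_ : DecidableEquality V) where
  open import Data.List.Membership.DecPropositional _≟_ using (_∈?_)

  private
    bit : {A : Set} → Dec A → Fin 2
    bit (yes _) = suc zero
    bit (no _)  = zero

    bit-injective : ∀ {A B : Set} (A? : Dec A) (B? : Dec B) → bit A? ≡ bit B? → A → B
    bit-injective (yes a) (yes b) _  _ = b
    bit-injective (no ¬a) _       _  a = contradiction a ¬a

    code : (U : List V) → List V → Fin (2 ^ length U)
    code []      σ = zero
    code (u ∷ U) σ = combine (bit (u ∈? σ)) (code U σ)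

    code-injective : ∀ U {σ τ} → code U σ ≡ code U τ → ∀ {v} → v ∈ U → v ∈ σ → v ∈ τ
    code-injective (u ∷ U) {σ} {τ} eq v∈
      with Fin.combine-injective (bit (u ∈? σ)) (code U σ) (bit (u ∈? τ)) (code U τ) eq | v∈
    ... | eq₁ , _  | here refl = bit-injective (u ∈? σ) (u ∈? τ) eq₁
    ... | _  , eq₂ | there v∈U = code-injective U eq₂ v∈U

  facet-order-wellFounded : (Δ : SimplicialComplex V) (U : List V) →
    (∀ (σ : Facet Δ) {v} → v ∈ proj₁ σ → v ∈ U) →
    ∀ {_≺_} → IsStrictTotalOrder (_≈_ Δ) _≺_ → WellFounded _≺_
  facet-order-wellFounded Δ U ⊆U {_≺_} sto =
    Subrelation.wellFounded (λ {σ} {τ} σ≺τ → σ , τ , refl , refl , σ≺τ)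
      (On.wellFounded ⟦_⟧ (spo-wellFounded spo))
    where
    module O = IsStrictTotalOrder sto
    ⟦_⟧ : Facet Δ → Fin (2 ^ length U)
    ⟦ σ ⟧ = code U (proj₁ σ)
    ≡⇒≈ : ∀ σ τ → ⟦ σ ⟧ ≡ ⟦ τ ⟧ → _≈_ Δ σ τ
    ≡⇒≈ σ τ eq = (λ v∈ → code-injective U eq (⊆U σ v∈) v∈) , (λ v∈ → code-injective U (sym eq) (⊆U τ v∈) v∈)
    _⊏_ : Rel (Fin (2 ^ length U)) 0ℓ
    i ⊏ j = ∃₂ λ σ τ → ⟦ σ ⟧ ≡ i × ⟦ τ ⟧ ≡ j × σ ≺ τ
    spo : IsStrictPartialOrder _≡_ _⊏_
    spo = record
      { isEquivalence = isEquivalence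
      ; irrefl   = λ { refl (σ , τ , eq , eq′ , σ≺τ) → O.irrefl (≡⇒≈ σ τ (trans eq (sym eq′))) σ≺τ }
      ; trans    = λ (σ , τ , eq₁ , eq₂ , σ≺τ) (τ′ , υ , eq₃ , eq₄ , τ′≺υ) →
          σ , υ , eq₁ , eq₄ , O.trans σ≺τ (proj₂ O.<-resp-≈ (≡⇒≈ τ′ τ (trans eq₃ (sym eq₂))) τ′≺υ)
      ; <-resp-≈ = (λ { refl → id }) , λ { refl → id } }

module Separation {V : Set} (_≟_ : DecidableEquality V) (U : List V)
                  {_≤_ : Rel V 0ℓ} (_≤?_ : Decidable₂ _≤_) (≤-refl : ∀ {v} → v ≤ v) where
  open FiniteAntichains _≟_ U _≤?_
  open SimplicialComplex Δ

  _∥_ : Rel V 0ℓ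
  u ∥ v = ¬ (u ≤ v) × ¬ (v ≤ u)

  _∥?_ : Decidable₂ _∥_
  u ∥? v = ¬? (u ≤? v) ×-dec ¬? (v ≤? u)

  Cohesive : Pred V 0ℓ → Set
  Cohesive W = All (λ u → All (λ v → W u → W v → u ∥ v →
    Any (λ q → u ∥ q × v ∥ q) U × All (λ q → u ∥ q → v ∥ q → W q) U) U) U

  private
    Meets : Pred V 0ℓ → Pred (Facet Δ) 0ℓ
    Meets W (σ , _) = ∃₂ λ u v → u ∈ σ × v ∈ σ × u ≢ v × W u × W v

    distinct⇒∥ : ∀ {σ u v} → Face σ → u ∈ σ → v ∈ σ → u ≢ v → u ∥ v
    distinct⇒∥ (_ , anti) u∈ v∈ u≢v = u≢v ∘ anti u∈ v∈ , u≢v ∘ sym ∘ anti v∈ u∈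

    ∥⇒compatible : ∀ {u v} → u ∥ v → Compatible v u
    ∥⇒compatible (a , b) = ⊥-elim ∘ b , ⊥-elim ∘ a

    module _ {W : Pred V 0ℓ} (cohesive : Cohesive W) where

      ⊆W : ∀ τ → Meets W τ → ∀ {w} → w ∈ proj₁ τ → W w
      ⊆W (τ , fτ , _) (u , v , u∈ , v∈ , u≢v , Wu , Wv) {w} w∈ with u ≟ w | v ≟ w
      ... | yes refl | _        = Wu
      ... | _        | yes refl = Wv
      ... | no u≢w   | no v≢w   = All.lookup
        (proj₂ (All.lookup (All.lookup cohesive (proj₁ fτ u∈)) (proj₁ fτ v∈) Wu Wv (distinct⇒∥ fτ u∈ v∈ u≢v)))
        (proj₁ fτ w∈) (distinct⇒∥ fτ u∈ w∈ u≢w) (distinct⇒∥ fτ v∈ w∈ v≢w)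

      third : ∀ τ → ((u , v , _) : Meets W τ) → ∃ λ w → w ∈ proj₁ τ × u ≢ w × v ≢ w
      third 𝛕@(τ , fτ , _) (u , v , u∈ , v∈ , u≢v , Wu , Wv)
        with any? (λ w → ¬? (u ≟ w) ×-dec ¬? (v ≟ w)) τ
      ... | yes p = find p
      ... | no none with find (proj₁
              (All.lookup (All.lookup cohesive (proj₁ fτ u∈)) (proj₁ fτ v∈) Wu Wv (distinct⇒∥ fτ u∈ v∈ u≢v)))
      ...   | q , q∈U , u∥q , v∥q = q , facet-absorbs 𝛕 q∈U comp
              , (λ { refl → proj₁ u∥q ≤-refl }) , λ { refl → proj₁ v∥q ≤-refl }
        where
        comp : ∀ {w} → w ∈ τ → Compatible q w
        comp {w} w∈ with u ≟ w | v ≟ w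
        ... | yes refl | _        = ∥⇒compatible u∥q
        ... | _        | yes refl = ∥⇒compatible v∥q
        ... | no u≢w   | no v≢w   = contradiction (Any.map (λ { refl → u≢w , v≢w }) w∈) none

      meets-remove : ∀ τ γ {x} → (∀ {v} → v ∈ proj₁ τ → x ≢ v → v ∈ proj₁ γ) → Meets W τ → Meets W γ
      meets-remove τ γ {x} τ∖x⊆γ m@(u , v , u∈ , v∈ , u≢v , Wu , Wv) with third τ m | x ≟ u | x ≟ v
      ... | w , w∈ , u≢w , v≢w | yes refl | _        =
        v , w , τ∖x⊆γ v∈ u≢v , τ∖x⊆γ w∈ u≢w , v≢w , Wv , ⊆W τ m w∈
      ... | w , w∈ , u≢w , v≢w | _        | yes refl =
        u , w , τ∖x⊆γ u∈ (u≢v ∘ sym) , τ∖x⊆γ w∈ v≢w , u≢w , Wu , ⊆W τ m w∈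
      ... | _                  | no x≢u   | no x≢v   =
        u , v , τ∖x⊆γ u∈ x≢u , τ∖x⊆γ v∈ x≢v , u≢v , Wu , Wv

      meets-predecessor : ∀ {_≺_} → IsShelling Δ _≺_ → ∀ {σ τ} → σ ≺ τ → Meets W τ → ∃ λ γ → γ ≺ τ × Meets W γ
      meets-predecessor shelling {σ} {τ} σ≺τ m with shelling σ τ σ≺τ
      ... | γ , x , γ≺τ , _ , _ , _ , τ∖x⊆ =
        γ , γ≺τ , meets-remove τ γ (λ v∈ x≢v → proj₁ (τ∖x⊆ (v∈ , x≢v))) m

      meeting-facet : (∃₂ λ u v → u ∈ U × v ∈ U × W u × W v × u ∥ v) → ∃ (Meets W)
      meeting-facet (u , v , u∈ , v∈ , Wu , Wv , u∥v) with extend-facet face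
        where
        face : Face (u ∷ v ∷ [])
        face = insert (insert ((λ ()) , λ ()) v∈ (λ ())) u∈
          λ { (here refl) → ⊥-elim ∘ proj₁ u∥v , ⊥-elim ∘ proj₂ u∥v ; (there ()) }
      ... | γ , ⊆γ = γ , u , v , ⊆γ (here refl) , ⊆γ (there (here refl)) , (λ { refl → proj₁ u∥v ≤-refl }) , Wu , Wv

  -- A facet with two vertices in a cohesive W has at least three, all in W; so the facet preceding
  -- it that a shelling provides again has two vertices in W.  Starting from one such facet for W₁
  -- and one for W₂, the later of the two can be lowered forever.
  separated⇒¬shellable : ∀ {W₁ W₂} → Cohesive W₁ → Cohesive W₂ → (∀ {v} → W₁ v → ¬ W₂ v) →
    (∃₂ λ u v → u ∈ U × v ∈ U × W₁ u × W₁ v × u ∥ v) →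
    (∃₂ λ u v → u ∈ U × v ∈ U × W₂ u × W₂ v × u ∥ v) → ¬ Shellable Δ
  separated⇒¬shellable {W₁} {W₂} coh₁ coh₂ disjoint pair₁ pair₂ (_≺_ , sto , shelling)
    with meeting-facet coh₁ pair₁ | meeting-facet coh₂ pair₂
  ... | σ , m₁ | τ , m₂ = descend σ τ (wf σ) (wf τ) m₁ m₂
    where
    module O = IsStrictTotalOrder sto
    wf : WellFounded _≺_
    wf = facet-order-wellFounded _≟_ Δ U (λ (_ , fσ , _) → proj₁ fσ) sto
    descend : ∀ σ τ → Acc _≺_ σ → Acc _≺_ τ → Meets W₁ σ → Meets W₂ τ → ⊥
    descend σ τ (acc rσ) (acc rτ) m₁ m₂ with O.compare σ τ
    ... | tri≈ _ (σ⊆τ , _) _ = let u , _ , u∈ , _ , _ , Wu , _ = m₁ in disjoint Wu (⊆W coh₂ τ m₂ (σ⊆τ u∈))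
    ... | tri< σ≺τ _ _ with meets-predecessor coh₂ shelling σ≺τ m₂
    ...   | γ , γ≺τ , mγ = descend σ γ (acc rσ) (rτ γ≺τ) m₁ mγ
    descend σ τ (acc rσ) (acc rτ) m₁ m₂ | tri> _ _ τ≺σ with meets-predecessor coh₁ shelling τ≺σ m₁
    ...   | γ , γ≺σ , mγ = descend γ τ (rσ γ≺σ) (acc rτ) mγ m₂

infix 4 _≼_ _≼?_

_≼_ : ∀ {r} → Rel (Vec ℕ r) 0ℓ
_≼_ = Pointwise _≤_

_≼?_ : ∀ {r} → Decidable₂ (_≼_ {r})
_≼?_ = PW.decidable ℕ._≤?_

module _ {r} (C : List (Vec ℕ r)) (a b : ℕ) where
  open Separation (Vec.≡-dec ℕ._≟_) C _≼?_ (PW.refl ℕ.≤-refl)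

  private
    Low High : Pred (Vec ℕ r) 0ℓ
    Low  c = Vec.sum c < a
    High c = a ≤ Vec.sum c × Vec.sum c ≤ b

    low? : Decidable Low
    low? c = Vec.sum c ℕ.<? a

    high? : Decidable High
    high? c = (a ℕ.≤? Vec.sum c) ×-dec (Vec.sum c ℕ.≤? b)

    cohesive? : ∀ {W} → Decidable W → Dec (Cohesive W)
    cohesive? W? = all? (λ u → all? (λ v → W? u →-dec W? v →-dec (u ∥? v) →-dec
      any? (λ q → (u ∥? q) ×-dec (v ∥? q)) C ×-dec all? (λ q → (u ∥? q) →-dec (v ∥? q) →-dec W? q) C) C) C

    HasPair : Pred (Vec ℕ r) 0ℓ → Set
    HasPair W = Any (λ u → Any (λ v → W u × W v × u ∥ v) C) C

    hasPair? : ∀ {W} → Decidable W → Dec (HasPair W)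
    hasPair? W? = any? (λ u → any? (λ v → W? u ×-dec W? v ×-dec (u ∥? v)) C) C

    pair : ∀ {W} → HasPair W → ∃₂ λ u v → u ∈ C × v ∈ C × W u × W v × u ∥ v
    pair p with find p
    ... | u , u∈ , p′ with find p′
    ...   | v , v∈ , Wu , Wv , u∥v = u , v , u∈ , v∈ , Wu , Wv , u∥v

    Separated : Set
    Separated = Cohesive Low × Cohesive High × HasPair Low × HasPair High

    separated? : Dec Separated
    separated? = cohesive? low? ×-dec cohesive? high? ×-dec hasPair? low? ×-dec hasPair? high?

  heights-separated : {True separated?} → ¬ Shellable (antichainComplex (_∈ C) _≼_)
  heights-separated {sep} with toWitness sep
  ... | cohˡ , cohʰ , pairˡ , pairʰ =
    separated⇒¬shellable cohˡ cohʰ (λ low (a≤ , _) → ℕ.<⇒≱ low a≤) (pair pairˡ) (pair pairʰ)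

-- Positive roots as coefficient vectors; the second simple root of D₄ is the central node.
coefficientsD₄ : List (Vec ℕ 4)
coefficientsD₄ =
    (1 ∷ 0 ∷ 0 ∷ 0 ∷ []) ∷ (0 ∷ 1 ∷ 0 ∷ 0 ∷ []) ∷ (0 ∷ 0 ∷ 1 ∷ 0 ∷ []) ∷ (0 ∷ 0 ∷ 0 ∷ 1 ∷ [])
  ∷ (1 ∷ 1 ∷ 0 ∷ 0 ∷ []) ∷ (0 ∷ 1 ∷ 1 ∷ 0 ∷ []) ∷ (0 ∷ 1 ∷ 0 ∷ 1 ∷ [])
  ∷ (1 ∷ 1 ∷ 1 ∷ 0 ∷ []) ∷ (1 ∷ 1 ∷ 0 ∷ 1 ∷ []) ∷ (0 ∷ 1 ∷ 1 ∷ 1 ∷ [])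
  ∷ (1 ∷ 1 ∷ 1 ∷ 1 ∷ []) ∷ (1 ∷ 2 ∷ 1 ∷ 1 ∷ []) ∷ []

coefficientsF₄ : List (Vec ℕ 4)
coefficientsF₄ =
    (1 ∷ 0 ∷ 0 ∷ 0 ∷ []) ∷ (0 ∷ 1 ∷ 0 ∷ 0 ∷ []) ∷ (0 ∷ 0 ∷ 1 ∷ 0 ∷ []) ∷ (0 ∷ 0 ∷ 0 ∷ 1 ∷ [])
  ∷ (1 ∷ 1 ∷ 0 ∷ 0 ∷ []) ∷ (0 ∷ 1 ∷ 1 ∷ 0 ∷ []) ∷ (0 ∷ 0 ∷ 1 ∷ 1 ∷ [])
  ∷ (1 ∷ 1 ∷ 1 ∷ 0 ∷ []) ∷ (0 ∷ 1 ∷ 2 ∷ 0 ∷ []) ∷ (0 ∷ 1 ∷ 1 ∷ 1 ∷ [])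
  ∷ (1 ∷ 1 ∷ 2 ∷ 0 ∷ []) ∷ (1 ∷ 1 ∷ 1 ∷ 1 ∷ []) ∷ (0 ∷ 1 ∷ 2 ∷ 1 ∷ [])
  ∷ (1 ∷ 2 ∷ 2 ∷ 0 ∷ []) ∷ (1 ∷ 1 ∷ 2 ∷ 1 ∷ []) ∷ (0 ∷ 1 ∷ 2 ∷ 2 ∷ [])
  ∷ (1 ∷ 2 ∷ 2 ∷ 1 ∷ []) ∷ (1 ∷ 1 ∷ 2 ∷ 2 ∷ []) ∷ (1 ∷ 2 ∷ 3 ∷ 1 ∷ []) ∷ (1 ∷ 2 ∷ 2 ∷ 2 ∷ [])
  ∷ (1 ∷ 2 ∷ 3 ∷ 2 ∷ []) ∷ (1 ∷ 2 ∷ 4 ∷ 2 ∷ []) ∷ (1 ∷ 3 ∷ 4 ∷ 2 ∷ []) ∷ (2 ∷ 3 ∷ 4 ∷ 2 ∷ []) ∷ []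

coefficientsD₄-¬shellable : ¬ Shellable (antichainComplex (_∈ coefficientsD₄) _≼_)
coefficientsD₄-¬shellable = heights-separated coefficientsD₄ 3 3

coefficientsF₄-¬shellable : ¬ Shellable (antichainComplex (_∈ coefficientsF₄) _≼_)
coefficientsF₄-¬shellable = heights-separated coefficientsF₄ 4 5

-- Non-negative combinations and functionals

infix 8 _∙_

_∙_ : ∀ {m} → ℤ^ m → ℤ^ m → ℤ
[]      ∙ []      = 0ℤ
(x ∷ w) ∙ (y ∷ v) = x *ℤ y +ℤ w ∙ v

∙-⊕ : ∀ {m} (w u v : ℤ^ m) → w ∙ (u ⊕ v) ≡ w ∙ u +ℤ w ∙ v
∙-⊕ []      []      []      = refl
∙-⊕ (x ∷ w) (y ∷ u) (z ∷ v) rewrite ∙-⊕ w u v =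
  solve 5 (λ x y z a b → x :* (y :+ z) :+ (a :+ b) := (x :* y :+ a) :+ (x :* z :+ b)) refl x y z (w ∙ u) (w ∙ v)

∙-⊖ : ∀ {m} (w u v : ℤ^ m) → w ∙ (u ⊖ v) ≡ w ∙ u -ℤ w ∙ v
∙-⊖ []      []      []      = refl
∙-⊖ (x ∷ w) (y ∷ u) (z ∷ v) rewrite ∙-⊖ w u v =
  solve 5 (λ x y z a b → x :* (y :- z) :+ (a :- b) := (x :* y :+ a) :- (x :* z :+ b)) refl x y z (w ∙ u) (w ∙ v)

∙-· : ∀ {m} k (w v : ℤ^ m) → w ∙ (k · v) ≡ k *ℤ w ∙ v
∙-· k []      []      = sym (ℤ.*-zeroʳ k)
∙-· k (x ∷ w) (y ∷ v) rewrite ∙-· k w v =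
  solve 4 (λ k x y a → x :* (k :* y) :+ k :* a := k :* (x :* y :+ a)) refl k x y (w ∙ v)

∙-0⃗ : ∀ {m} (w : ℤ^ m) → w ∙ 0⃗ ≡ 0ℤ
∙-0⃗ []      = refl
∙-0⃗ (x ∷ w) rewrite ∙-0⃗ w | ℤ.*-zeroʳ x = refl

0⃗∙ : ∀ {m} (v : ℤ^ m) → 0⃗ ∙ v ≡ 0ℤ
0⃗∙ []      = refl
0⃗∙ (x ∷ v) rewrite 0⃗∙ v = refl

∙-e : ∀ {m} (w : ℤ^ m) i → w ∙ e i ≡ Vec.lookup w i
∙-e (x ∷ w) zero    rewrite ∙-0⃗ w = solve 1 (λ x → x :* con 1ℤ :+ con 0ℤ := x) refl x
∙-e (x ∷ w) (suc i) rewrite ∙-e w i | ℤ.*-zeroʳ x = ℤ.+-identityˡ _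

0·⊕ : ∀ {m} (u v : ℤ^ m) → 0ℤ · u ⊕ v ≡ v
0·⊕ []      []      = refl
0·⊕ (x ∷ u) (y ∷ v) = cong₂ _∷_ (ℤ.+-identityˡ y) (0·⊕ u v)

1·⊕0⃗ : ∀ {m} (u : ℤ^ m) → 1ℤ · u ⊕ 0⃗ ≡ u
1·⊕0⃗ []      = refl
1·⊕0⃗ (x ∷ u) = cong₂ _∷_ (solve 1 (λ x → con 1ℤ :* x :+ con 0ℤ := x) refl x) (1·⊕0⃗ u)

0⃗⊕ : ∀ {m} (v : ℤ^ m) → 0⃗ ⊕ v ≡ v
0⃗⊕ []      = refl
0⃗⊕ (x ∷ v) = cong₂ _∷_ (ℤ.+-identityˡ x) (0⃗⊕ v)

⊖-self : ∀ {m} (v : ℤ^ m) → v ⊖ v ≡ 0⃗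
⊖-self []      = refl
⊖-self (x ∷ v) = cong₂ _∷_ (ℤ.+-inverseʳ x) (⊖-self v)

⊖≡⇒≡⊕ : ∀ {m} (v u w : ℤ^ m) → v ⊖ u ≡ w → v ≡ u ⊕ w
⊖≡⇒≡⊕ []      []      []      _    = refl
⊖≡⇒≡⊕ (x ∷ v) (y ∷ u) (_ ∷ _) refl =
  cong₂ _∷_ (solve 2 (λ x y → x := y :+ (x :- y)) refl x y) (⊖≡⇒≡⊕ v u _ refl)

⊕-⊖ : ∀ {m} (u w : ℤ^ m) → (u ⊕ w) ⊖ u ≡ w
⊕-⊖ []      []      = refl
⊕-⊖ (x ∷ u) (y ∷ w) = cong₂ _∷_ (solve 2 (λ x y → (x :+ y) :- x := y) refl x y) (⊕-⊖ u w)

⊖-⊕-⊖ : ∀ {m} (a b c : ℤ^ m) → (a ⊖ b) ⊕ (b ⊖ c) ≡ a ⊖ c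
⊖-⊕-⊖ []      []      []      = refl
⊖-⊕-⊖ (x ∷ a) (y ∷ b) (z ∷ c) =
  cong₂ _∷_ (solve 3 (λ x y z → (x :- y) :+ (y :- z) := x :- z) refl x y z) (⊖-⊕-⊖ a b c)

⊖-⊖-⊖ : ∀ {m} (a b c d : ℤ^ m) → (a ⊖ b) ⊖ (c ⊖ d) ≡ (a ⊖ c) ⊕ (d ⊖ b)
⊖-⊖-⊖ []      []      []      []      = refl
⊖-⊖-⊖ (x ∷ a) (y ∷ b) (z ∷ c) (t ∷ d) =
  cong₂ _∷_ (solve 4 (λ x y z t → (x :- y) :- (z :- t) := (x :- z) :+ (t :- y)) refl x y z t) (⊖-⊖-⊖ a b c d)

linComb-zero : ∀ {m} (S : List (ℤ^ m)) → linComb S (Vec.replicate _ 0) ≡ 0⃗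
linComb-zero []      = refl
linComb-zero (α ∷ S) rewrite linComb-zero S = 0·⊕ α 0⃗

private
  ·⊕-interchange : ∀ {m} (k l : ℕ) (α u v : ℤ^ m) →
    (+ k · α ⊕ u) ⊕ (+ l · α ⊕ v) ≡ + (k ℕ.+ l) · α ⊕ (u ⊕ v)
  ·⊕-interchange k l []      []      []      = refl
  ·⊕-interchange k l (x ∷ α) (y ∷ u) (z ∷ v) = cong₂ _∷_
    (trans (solve 5 (λ k l x y z → (k :* x :+ y) :+ (l :* x :+ z) := (k :+ l) :* x :+ (y :+ z)) refl (+ k) (+ l) x y z)
           (cong (λ n → n *ℤ x +ℤ (y +ℤ z)) (sym (ℤ.pos-+ k l))))
    (·⊕-interchange k l α u v)

linComb-+ : ∀ {m} (S : List (ℤ^ m)) c d → linComb S (Vec.zipWith ℕ._+_ c d) ≡ linComb S c ⊕ linComb S d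
linComb-+ []      []      []      = sym (0⃗⊕ 0⃗)
linComb-+ (α ∷ S) (k ∷ c) (l ∷ d) rewrite linComb-+ S c d = sym (·⊕-interchange k l α _ _)

*-pos-cancel : ∀ k l {x} → 0ℤ <ℤ x → + k *ℤ x ≡ + l *ℤ x → k ≡ l
*-pos-cancel k l {+ zero}  (+<+ ()) _
*-pos-cancel k l {+ suc n} _ eq = ℤ.+-injective (ℤ.*-cancelʳ-≡ (+ k) (+ l) (+ suc n) eq)

module _ {m : ℕ} where

  0⃗∈ : ∀ (S : List (ℤ^ m)) → 0⃗ ∈ℕ⟨ S ⟩
  0⃗∈ S = _ , sym (linComb-zero S)

  ⊕-∈ : ∀ (S : List (ℤ^ m)) {u v} → u ∈ℕ⟨ S ⟩ → v ∈ℕ⟨ S ⟩ → u ⊕ v ∈ℕ⟨ S ⟩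
  ⊕-∈ S (c , refl) (d , refl) = _ , sym (linComb-+ S c d)

  generator-∈ : ∀ {S : List (ℤ^ m)} {α} → α ∈ S → α ∈ℕ⟨ S ⟩
  generator-∈ {α ∷ S} (here refl) = 1 ∷ Vec.replicate _ 0 ,
    sym (trans (cong (1ℤ · α ⊕_) (linComb-zero S)) (1·⊕0⃗ α))
  generator-∈ {α ∷ S} (there α∈S) with generator-∈ {S} α∈S
  ... | c , refl = 0 ∷ c , sym (0·⊕ α (linComb S c))

  ·-∈ : ∀ (S : List (ℤ^ m)) {v} k → v ∈ℕ⟨ S ⟩ → + k · v ∈ℕ⟨ S ⟩
  ·-∈ S {v} zero    v∈ = subst (_∈ℕ⟨ S ⟩) (sym (0· v)) (0⃗∈ S)
    where
    0· : ∀ {m} (v : ℤ^ m) → 0ℤ · v ≡ 0⃗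
    0· []      = refl
    0· (x ∷ v) = cong (0ℤ ∷_) (0· v)
  ·-∈ S {v} (suc k) v∈ = subst (_∈ℕ⟨ S ⟩) (suc· v) (⊕-∈ S v∈ (·-∈ S k v∈))
    where
    suc· : ∀ {m} (v : ℤ^ m) → v ⊕ + k · v ≡ + suc k · v
    suc· []      = refl
    suc· (x ∷ v) = cong₂ _∷_ (solve 2 (λ k x → x :+ k :* x := (con 1ℤ :+ k) :* x) refl (+ k) x) (suc· v)

  ∈ℕ-mono : ∀ {S T : List (ℤ^ m)} → S ⊆ₗ T → ∀ {v} → v ∈ℕ⟨ S ⟩ → v ∈ℕ⟨ T ⟩
  ∈ℕ-mono {[]}    {T} S⊆T ([]    , refl) = 0⃗∈ T
  ∈ℕ-mono {α ∷ S} {T} S⊆T (k ∷ c , refl) =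
    ⊕-∈ T (·-∈ T k (generator-∈ (S⊆T (here refl)))) (∈ℕ-mono {S} (S⊆T ∘ there) (c , refl))

  private
    +*-nonneg : ∀ k {x} → 0ℤ ≤ℤ x → 0ℤ ≤ℤ + k *ℤ x
    +*-nonneg k {+ n} _ = subst (0ℤ ≤ℤ_) (ℤ.pos-* k n) (+≤+ z≤n)

  ∙-nonneg : ∀ {S : List (ℤ^ m)} w → All (λ α → 0ℤ ≤ℤ w ∙ α) S → ∀ {v} → v ∈ℕ⟨ S ⟩ → 0ℤ ≤ℤ w ∙ v
  ∙-nonneg w []        ([]    , refl) = subst (0ℤ ≤ℤ_) (sym (∙-0⃗ w)) ℤ.≤-refl
  ∙-nonneg {α ∷ S} w (p ∷ ps) (k ∷ c , refl)
    rewrite ∙-⊕ w (+ k · α) (linComb S c) | ∙-· (+ k) w α =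
    ℤ.+-mono-≤ (+*-nonneg k p) (∙-nonneg {S} w ps (c , refl))

  ∙-vanish : ∀ {S : List (ℤ^ m)} w → All (λ α → w ∙ α ≡ 0ℤ) S → ∀ {v} → v ∈ℕ⟨ S ⟩ → w ∙ v ≡ 0ℤ
  ∙-vanish w []        ([]    , refl) = ∙-0⃗ w
  ∙-vanish {α ∷ S} w (p ∷ ps) (k ∷ c , refl)
    rewrite ∙-⊕ w (+ k · α) (linComb S c) | ∙-· (+ k) w α | p
          | ℤ.*-zeroʳ (+ k) | ∙-vanish {S} w ps {linComb S c} (c , refl) = refl

  ∙-head : ∀ {S : List (ℤ^ m)} w α → All (λ β → w ∙ β ≡ 0ℤ) S → ∀ k c → w ∙ linComb (α ∷ S) (k ∷ c) ≡ + k *ℤ w ∙ α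
  ∙-head {S} w α ps k c
    rewrite ∙-⊕ w (+ k · α) (linComb S c) | ∙-· (+ k) w α | ∙-vanish {S} w ps {linComb S c} (c , refl) = ℤ.+-identityʳ _

  ∙-positive⇒0⃗ : ∀ {S : List (ℤ^ m)} h → All (λ α → 0ℤ <ℤ h ∙ α) S → ∀ {v} → v ∈ℕ⟨ S ⟩ → h ∙ v ≤ℤ 0ℤ → v ≡ 0⃗
  ∙-positive⇒0⃗ h []        ([]    , refl) _ = refl
  ∙-positive⇒0⃗ {α ∷ S} h (p ∷ ps) (zero ∷ c , refl) hv≤0 rewrite 0·⊕ α (linComb S c) =
    ∙-positive⇒0⃗ {S} h ps (c , refl) hv≤0
  ∙-positive⇒0⃗ {α ∷ S} h (p ∷ ps) (suc k ∷ c , refl) hv≤0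
    rewrite ∙-⊕ h (+ suc k · α) (linComb S c) | ∙-· (+ suc k) h α =
    ⊥-elim (ℤ.<⇒≱ (ℤ.+-mono-<-≤ (suc*-pos p) (∙-nonneg {S} h (All.map ℤ.<⇒≤ ps) (c , refl))) hv≤0)
    where
    suc*-pos : ∀ {x} → 0ℤ <ℤ x → 0ℤ <ℤ + suc k *ℤ x
    suc*-pos {+ zero}  (+<+ ())
    suc*-pos {+ suc n} _ = +<+ (s≤s z≤n)

-- A triangular form of linear independence, certified by functionals.
Independent : ∀ {m} → List (ℤ^ m) → Set
Independent []      = ⊤
Independent (α ∷ S) = (∃ λ w → 0ℤ <ℤ w ∙ α × All (λ β → w ∙ β ≡ 0ℤ) S) × Independent S

linComb-injective : ∀ {m} {S : List (ℤ^ m)} → Independent S → ∀ c d → linComb S c ≡ linComb S d → c ≡ d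
linComb-injective {S = []}    _                    []      []      _  = refl
linComb-injective {S = α ∷ S} ((w , pos , van) , ind) (k ∷ c) (l ∷ d) eq
  with *-pos-cancel k l pos (trans (sym (∙-head w α van k c)) (trans (cong (w ∙_) eq) (∙-head w α van l d)))
... | refl = cong (k ∷_) (linComb-injective {S = S} ind c d (⊕-cancelˡ (+ k · α) eq))
  where
  ⊕-cancelˡ : ∀ {m} (u : ℤ^ m) {v w} → u ⊕ v ≡ u ⊕ w → v ≡ w
  ⊕-cancelˡ u {v} {w} eq = trans (sym (⊕-⊖ u v)) (trans (cong (_⊖ u) eq) (⊕-⊖ u w))

rootSystem : ∀ {m} → Pred (ℤ^ m) 0ℓ → List (ℤ^ m) → RootSystem
rootSystem Φ S = record { Φ = Φ ; simple = S }

≼⇒∃+ : ∀ {r} {c d : Vec ℕ r} → c ≼ d → ∃ λ b → d ≡ Vec.zipWith ℕ._+_ c b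
≼⇒∃+ []       = [] , refl
≼⇒∃+ {c = k ∷ _} {l ∷ _} (k≤l ∷ c≼d) with ≼⇒∃+ c≼d
... | b , refl = l ℕ.∸ k ∷ b , cong (_∷ _) (sym (ℕ.m+[n∸m]≡n k≤l))

≼-+ : ∀ {r} (c b : Vec ℕ r) → c ≼ Vec.zipWith ℕ._+_ c b
≼-+ []      []      = []
≼-+ (k ∷ c) (l ∷ b) = ℕ.m≤m+n k l ∷ ≼-+ c b

module _ {m} {Φ : Pred (ℤ^ m) 0ℓ} {S : List (ℤ^ m)} {C : List (Vec ℕ (length S))} where

  coefficients-shellable :
    Independent S → All (Φ ∘ linComb S) C →
    (∀ {v} → Φ v → v ∈ℕ⟨ S ⟩ → ∃ λ c → c ∈ C × v ≡ linComb S c) →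
    Shellable (antichains (rootSystem Φ S)) → Shellable (antichainComplex (_∈ C) _≼_)
  coefficients-shellable ind allΦ complete = link-shellable {ρ = []} {ι = linComb S} (isLink record
    { refl-≤       = λ {α} _ → subst (_∈ℕ⟨ S ⟩) (sym (⊖-self α)) (0⃗∈ S)
    ; base         = (λ ()) , λ ()
    ; into         = λ c∈C → All.lookup allΦ c∈C , _ , refl
    ; mono         = mono
    ; reflect      = λ {c} {d} _ _ (b , eq) → subst (c ≼_)
        (sym (linComb-injective ind d _ (trans (⊖≡⇒≡⊕ _ _ _ eq) (sym (linComb-+ S c b))))) (≼-+ c b)
    ; injective    = λ {c} {d} _ _ → linComb-injective ind c d
    ; incomparable = λ ()
    ; covers       = λ (Φv , v∈) _ → inj₂ (complete Φv v∈)
    })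
    where
    mono : ∀ {c d} → c ∈ C → d ∈ C → c ≼ d → linComb S d ⊖ linComb S c ∈ℕ⟨ S ⟩
    mono {c} _ _ c≼d with ≼⇒∃+ c≼d
    ... | b , refl = b , trans (cong (_⊖ linComb S c) (linComb-+ S c b)) (⊕-⊖ (linComb S c) (linComb S b))

module _ {m} {Φ : Pred (ℤ^ m) 0ℓ} {S S′ : List (ℤ^ m)} (α : ℤ^ m) where

  -- The roots incomparable to a simple root α are those without α in their support.
  remove-simple : (∀ {v} → Φ v → v ≢ 0⃗) → Φ α → S ⊆ₗ α ∷ S′ → α ∷ S′ ⊆ₗ S →
    (w : ℤ^ m) → 0ℤ <ℤ w ∙ α → All (λ β → w ∙ β ≡ 0ℤ) S′ →
    (h : ℤ^ m) → All (λ β → 0ℤ <ℤ h ∙ β) S′ →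
    Shellable (antichains (rootSystem Φ S)) → Shellable (antichains (rootSystem Φ S′))
  remove-simple Φ≢0⃗ Φα S⊆ ⊆S w wα>0 wS′≡0 h hS′>0 = link-shellable {ρ = α ∷ []} {ι = id} (isLink record
    { refl-≤       = λ {α} _ → subst (_∈ℕ⟨ S ⟩) (sym (⊖-self α)) (0⃗∈ S)
    ; base         = (λ { (here refl) → Φα , generator-∈ (⊆S (here refl)) })
                   , λ { (here refl) (here refl) _ → refl }
    ; into         = λ (Φv , v∈) → Φv , ∈ℕ-mono (⊆S ∘ there) v∈
    ; mono         = λ _ _ → ∈ℕ-mono (⊆S ∘ there)
    ; reflect      = λ {u} {v} (_ , u∈) (_ , v∈) d∈ → S′-part
        (trans (∙-⊖ w v u) (cong₂ _-ℤ_ (∙-vanish {S = S′} w wS′≡0 v∈) (∙-vanish {S = S′} w wS′≡0 u∈))) (∈ℕ-mono S⊆ d∈)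
    ; injective    = λ _ _ → id
    ; incomparable = λ { {v = v} (here refl) (Φv , v∈) → above v v∈ ∘ ∈ℕ-mono S⊆ , below v Φv v∈ ∘ ∈ℕ-mono S⊆ }
    ; covers       = covers
    })
    where
    S′-part : ∀ {v} → w ∙ v ≡ 0ℤ → v ∈ℕ⟨ α ∷ S′ ⟩ → v ∈ℕ⟨ S′ ⟩
    S′-part wv≡0 (k ∷ c , refl)
      with *-pos-cancel k 0 wα>0 (trans (sym (∙-head w α wS′≡0 k c)) wv≡0)
    ... | refl = c , 0·⊕ α (linComb S′ c)
    above : ∀ v → v ∈ℕ⟨ S′ ⟩ → ¬ (v ⊖ α ∈ℕ⟨ α ∷ S′ ⟩)
    above v v∈ d∈ = ℤ.<⇒≱ wα>0 (ℤ.i-j≤0⇒i≤j (subst (_≤ℤ 0ℤ)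
      (solve 1 (λ x → :- (con 0ℤ :- x) := x :- con 0ℤ) refl (w ∙ α))
      (ℤ.neg-mono-≤ (subst (0ℤ ≤ℤ_) (trans (∙-⊖ w v α) (cong (_-ℤ w ∙ α) (∙-vanish {S = S′} w wS′≡0 v∈)))
        (∙-nonneg {S = α ∷ S′} w (ℤ.<⇒≤ wα>0 ∷ All.map (ℤ.≤-reflexive ∘ sym) wS′≡0) d∈)))))
    below : ∀ v → Φ v → v ∈ℕ⟨ S′ ⟩ → ¬ (α ⊖ v ∈ℕ⟨ α ∷ S′ ⟩)
    below v Φv v∈ (k ∷ c , eq)
      with *-pos-cancel k 1 wα>0 (begin
             + k *ℤ w ∙ α                   ≡⟨ ∙-head w α wS′≡0 k c ⟨
             w ∙ linComb (α ∷ S′) (k ∷ c)   ≡⟨ cong (w ∙_) eq ⟨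
             w ∙ (α ⊖ v)                    ≡⟨ ∙-⊖ w α v ⟩
             w ∙ α -ℤ w ∙ v                 ≡⟨ cong (w ∙ α -ℤ_) (∙-vanish {S = S′} w wS′≡0 v∈) ⟩
             w ∙ α -ℤ 0ℤ                    ≡⟨ solve 1 (λ x → x :- con 0ℤ := con 1ℤ :* x) refl (w ∙ α) ⟩
             1ℤ *ℤ w ∙ α                    ∎)
      where open ≡-Reasoning
    ... | refl = Φ≢0⃗ Φv (∙-positive⇒0⃗ {S = S′} h hS′>0 v∈ hv≤0)
      where
      open ≡-Reasoning
      h∙-sum : h ∙ α -ℤ h ∙ v ≡ h ∙ α +ℤ h ∙ linComb S′ c
      h∙-sum = begin
        h ∙ α -ℤ h ∙ v                      ≡⟨ ∙-⊖ h α v ⟨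
        h ∙ (α ⊖ v)                         ≡⟨ cong (h ∙_) eq ⟩
        h ∙ (1ℤ · α ⊕ linComb S′ c)         ≡⟨ ∙-⊕ h (1ℤ · α) (linComb S′ c) ⟩
        h ∙ (1ℤ · α) +ℤ h ∙ linComb S′ c    ≡⟨ cong (_+ℤ h ∙ linComb S′ c) (trans (∙-· 1ℤ h α) (ℤ.*-identityˡ _)) ⟩
        h ∙ α +ℤ h ∙ linComb S′ c           ∎
      hv≡ : h ∙ v ≡ - (h ∙ linComb S′ c)
      hv≡ = trans (solve 2 (λ a b → b := a :- (a :- b)) refl (h ∙ α) (h ∙ v))
        (trans (cong (h ∙ α -ℤ_) h∙-sum) (solve 2 (λ a b → a :- (a :+ b) := :- b) refl (h ∙ α) (h ∙ linComb S′ c)))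
      hv≤0 : h ∙ v ≤ℤ 0ℤ
      hv≤0 = subst (_≤ℤ 0ℤ) (sym hv≡) (ℤ.neg-mono-≤ (∙-nonneg {S = S′} h (All.map ℤ.<⇒≤ hS′>0) (c , refl)))
    covers : ∀ {v} → Φ v × v ∈ℕ⟨ S ⟩ → (∀ {β} → β ∈ α ∷ [] → v ⊖ β ∈ℕ⟨ S ⟩ → β ≡ v) →
             v ∈ α ∷ [] ⊎ (∃ λ v′ → (Φ v′ × v′ ∈ℕ⟨ S′ ⟩) × v ≡ v′)
    covers (Φv , v∈) α≤v⇒α≡v with ∈ℕ-mono S⊆ v∈
    ... | zero  ∷ c , eq = inj₂ (_ , (Φv , c , trans eq (0·⊕ α (linComb S′ c))) , refl)
    ... | suc k ∷ c , eq = inj₁ (here (sym (α≤v⇒α≡v (here refl) (∈ℕ-mono ⊆S (k ∷ c ,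
        trans (cong (_⊖ α) eq) (pred α (linComb S′ c)))))))
      where
      pred : ∀ {m} (u v : ℤ^ m) → (+ suc k · u ⊕ v) ⊖ u ≡ + k · u ⊕ v
      pred []      []      = refl
      pred (x ∷ u) (y ∷ v) = cong₂ _∷_
        (solve 3 (λ k x y → ((con 1ℤ :+ k) :* x :+ y) :- x := k :* x :+ y) refl (+ k) x y) (pred u v)

-- Types D, F and E

_≟ᵥ_ : ∀ {m} → DecidableEquality (ℤ^ m)
_≟ᵥ_ = Vec.≡-dec _≟ℤ_

module _ {P : Pred Sign 0ℓ} (P? : Decidable P) where

  allSigns? : Dec (∀ s → P s)
  allSigns? = map′ (λ (p , n) → λ { Sign.+ → p ; Sign.- → n }) (λ f → f Sign.+ , f Sign.-) (P? Sign.+ ×-dec P? Sign.-)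

  anySign? : Dec (∃ P)
  anySign? = map′ [ Sign.+ ,_ , Sign.- ,_ ]′ (λ { (Sign.+ , p) → inj₁ p ; (Sign.- , n) → inj₂ n })
    (P? Sign.+ ⊎-dec P? Sign.-)

±≢0 : ∀ s → ± s ≢ 0ℤ
±≢0 Sign.+ ()
±≢0 Sign.- ()

±*0 : ∀ s → ± s *ℤ 0ℤ ≡ 0ℤ
±*0 s = ℤ.*-zeroʳ (± s)

±e±e-shift⁺ : ∀ {m} {v : ℤ^ m} → ±e±e v → ±e±e (0ℤ ∷ v)
±e±e-shift⁺ (i , j , s , t , i<j , refl) =
  suc i , suc j , s , t , s≤s i<j , cong (_∷ (± s · e i ⊕ ± t · e j)) (sym (cong₂ _+ℤ_ (±*0 s) (±*0 t)))

±e±e-shift⁻ : ∀ {m} {v : ℤ^ m} → ±e±e (0ℤ ∷ v) → ±e±e v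
±e±e-shift⁻ (suc i , suc j , s , t , s≤s i<j , eq) = i , j , s , t , i<j , Vec.∷-injectiveʳ eq
±e±e-shift⁻ (zero  , suc j , Sign.+ , Sign.+ , _ , ())
±e±e-shift⁻ (zero  , suc j , Sign.+ , Sign.- , _ , ())
±e±e-shift⁻ (zero  , suc j , Sign.- , Sign.+ , _ , ())
±e±e-shift⁻ (zero  , suc j , Sign.- , Sign.- , _ , ())

±e±e-≢0⃗ : ∀ {m} {v : ℤ^ m} → ±e±e v → v ≢ 0⃗
±e±e-≢0⃗ {suc m} {x ∷ v} p refl = ±e±e-≢0⃗ (±e±e-shift⁻ p) refl

±e±e? : ∀ {m} → Decidable (±e±e {m})
±e±e? v = Fin.any? λ i → Fin.any? λ j → anySign? λ s → anySign? λ t →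
  (i Fin.<? j) ×-dec (v ≟ᵥ (± s · e i ⊕ ± t · e j))

module _ {m} (W S : List (ℤ^ m)) where

  NonNegative : Set
  NonNegative = All (λ w → All (λ α → 0ℤ ≤ℤ w ∙ α) S) W

  nonNegative? : Dec NonNegative
  nonNegative? = all? (λ w → all? (λ α → 0ℤ ≤ℤ? w ∙ α) S) W

Negative : ∀ {m} → List (ℤ^ m) → Pred (ℤ^ m) 0ℓ
Negative W v = Any (λ w → w ∙ v <ℤ 0ℤ) W

negative? : ∀ {m} (W : List (ℤ^ m)) → Decidable (Negative W)
negative? W v = any? (λ w → w ∙ v <ℤ? 0ℤ) W

negative⇒∉ℕ : ∀ {m} {W S : List (ℤ^ m)} → NonNegative W S → ∀ {v} → Negative W v → ¬ (v ∈ℕ⟨ S ⟩)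
negative⇒∉ℕ {S = S} nonneg neg v∈ with find neg
... | w , w∈ , wv<0 = ℤ.<⇒≱ wv<0 (∙-nonneg {S = S} w (All.lookup nonneg w∈) v∈)

module _ {m} {X : Set} (W : List (ℤ^ m)) (f : X → ℤ^ m) (L : List X) where

  Accounted : Pred (ℤ^ m) 0ℓ
  Accounted v = Negative W v ⊎ Any (λ x → v ≡ f x) L

  accounted? : Decidable Accounted
  accounted? v = negative? W v ⊎-dec any? (λ x → v ≟ᵥ f x) L

  accounted-positive : ∀ {S v} → NonNegative W S → Accounted v → v ∈ℕ⟨ S ⟩ → ∃ λ x → x ∈ L × v ≡ f x
  accounted-positive         nonneg (inj₂ p)   _  = find p
  accounted-positive {S = S} nonneg (inj₁ neg) v∈ = contradiction v∈ (negative⇒∉ℕ {S = S} nonneg neg)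

module _ {m : ℕ} where
  open import Data.List.Relation.Binary.Subset.DecPropositional (_≟ᵥ_ {m}) using (_⊆?_)

  remove-simple-dec : ∀ {Φ : Pred (ℤ^ m) 0ℓ} {S S′ : List (ℤ^ m)} (α w h : ℤ^ m) →
    (∀ {v} → Φ v → v ≢ 0⃗) → Φ α → {True (S ⊆? α ∷ S′)} → {True (α ∷ S′ ⊆? S)} →
    {True (0ℤ <ℤ? w ∙ α)} → {True (all? (λ β → w ∙ β ≟ℤ 0ℤ) S′)} → {True (all? (λ β → 0ℤ <ℤ? h ∙ β) S′)} →
    Shellable (antichains (rootSystem Φ S)) → Shellable (antichains (rootSystem Φ S′))
  remove-simple-dec α w h Φ≢0⃗ Φα {S⊆} {⊆S} {wα} {wS′} {hS′} =
    remove-simple α Φ≢0⃗ Φα (toWitness S⊆) (toWitness ⊆S) w (toWitness wα) (toWitness wS′) h (toWitness hS′)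

D₄-¬shellable : ¬ Shellable (antichains (D 4))
D₄-¬shellable = coefficientsD₄-¬shellable ∘ coefficients-shellable
  ( ((+ 1 ∷ + 0 ∷ + 0 ∷ + 0 ∷ [])   , +<+ (s≤s z≤n) , refl ∷ refl ∷ refl ∷ [])
  , ((+ 1 ∷ + 1 ∷ + 0 ∷ + 0 ∷ [])   , +<+ (s≤s z≤n) , refl ∷ refl ∷ [])
  , ((+ 1 ∷ + 1 ∷ + 1 ∷ -1ℤ ∷ [])   , +<+ (s≤s z≤n) , refl ∷ [])
  , ((+ 1 ∷ + 1 ∷ + 1 ∷ + 1 ∷ [])   , +<+ (s≤s z≤n) , [])
  , tt)
  (from-yes (all? (λ c → ±e±e? (linComb S c)) coefficientsD₄))
  (λ { (i , j , s , t , i<j , refl) →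
       accounted-positive W (linComb S) coefficientsD₄ {S} (from-yes (nonNegative? W S)) (roots i j s t i<j) })
  where
  S = RootSystem.simple (D 4)
  W = (+ 1 ∷ + 0 ∷ + 0 ∷ + 0 ∷ []) ∷ (+ 1 ∷ + 1 ∷ + 0 ∷ + 0 ∷ [])
    ∷ (+ 1 ∷ + 1 ∷ + 1 ∷ -1ℤ ∷ []) ∷ (+ 1 ∷ + 1 ∷ + 1 ∷ + 1 ∷ []) ∷ []
  roots : ∀ i j s t → i Fin.< j → Accounted W (linComb S) coefficientsD₄ (± s · e i ⊕ ± t · e j)
  roots = from-yes (Fin.all? λ i → Fin.all? λ j → allSigns? λ s → allSigns? λ t →
    (i Fin.<? j) →-dec accounted? W (linComb S) coefficientsD₄ (± s · e i ⊕ ± t · e j))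

map-0∷-∈⁺ : ∀ {m} (S : List (ℤ^ m)) {v} → v ∈ℕ⟨ S ⟩ → 0ℤ ∷ v ∈ℕ⟨ map (0ℤ ∷_) S ⟩
map-0∷-∈⁺ []      ([]    , refl) = [] , refl
map-0∷-∈⁺ (α ∷ S) (k ∷ c , refl) with map-0∷-∈⁺ S (c , refl)
... | d , eq = k ∷ d , trans (cong (_∷ (+ k · α ⊕ linComb S c)) (sym (trans (ℤ.+-identityʳ _) (ℤ.*-zeroʳ (+ k)))))
                             (cong (+ k · (0ℤ ∷ α) ⊕_) eq)

map-0∷-∈⁻ : ∀ {m} (S : List (ℤ^ m)) {u} → u ∈ℕ⟨ map (0ℤ ∷_) S ⟩ → ∃ λ v → u ≡ 0ℤ ∷ v × v ∈ℕ⟨ S ⟩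
map-0∷-∈⁻ []      ([]    , refl) = 0⃗ , refl , [] , refl
map-0∷-∈⁻ (α ∷ S) (k ∷ c , refl) with map-0∷-∈⁻ S (c , refl)
... | v , eq , (d , refl) = + k · α ⊕ v
  , trans (cong (+ k · (0ℤ ∷ α) ⊕_) eq) (cong (_∷ (+ k · α ⊕ v)) (trans (ℤ.+-identityʳ _) (ℤ.*-zeroʳ (+ k))))
  , k ∷ d , refl

shift-shellable : ∀ {m} {Φ : Pred (ℤ^ (suc m)) 0ℓ} {Φ′ : Pred (ℤ^ m) 0ℓ} (S : List (ℤ^ m)) →
  (∀ {v} → Φ′ v → Φ (0ℤ ∷ v)) → (∀ {v} → Φ (0ℤ ∷ v) → Φ′ v) →
  Shellable (antichains (rootSystem Φ (map (0ℤ ∷_) S))) → Shellable (antichains (rootSystem Φ′ S))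
shift-shellable {m} {Φ} {Φ′} S up down = link-shellable {ρ = []} {ι = 0ℤ ∷_} (isLink record
  { refl-≤       = λ {α} _ → subst (_∈ℕ⟨ map (0ℤ ∷_) S ⟩) (sym (⊖-self α)) (0⃗∈ (map (0ℤ ∷_) S))
  ; base         = (λ ()) , λ ()
  ; into         = λ (Φv , v∈) → up Φv , map-0∷-∈⁺ S v∈
  ; mono         = λ _ _ → map-0∷-∈⁺ S
  ; reflect      = λ _ _ → lower
  ; injective    = λ _ _ → Vec.∷-injectiveʳ
  ; incomparable = λ ()
  ; covers       = covers
  })
  where
  lower : ∀ {v} → 0ℤ ∷ v ∈ℕ⟨ map (0ℤ ∷_) S ⟩ → v ∈ℕ⟨ S ⟩
  lower p with map-0∷-∈⁻ S p
  ... | _ , refl , v∈ = v∈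
  covers : ∀ {u} → Φ u × u ∈ℕ⟨ map (0ℤ ∷_) S ⟩ → _ → u ∈ [] ⊎ (∃ λ v → (Φ′ v × v ∈ℕ⟨ S ⟩) × u ≡ 0ℤ ∷ v)
  covers (Φu , u∈) _ with map-0∷-∈⁻ S u∈
  ... | v , refl , v∈ = inj₂ (v , (down Φu , v∈) , refl)

simpleD : ∀ k → List (ℤ^ (suc (suc k)))
simpleD k = RootSystem.simple (D (suc (suc k)))

differences-suc : ∀ k → differences (suc k) ≡ (e zero ⊖ e (suc zero)) ∷ map (0ℤ ∷_) (differences k)
differences-suc k = cong ((e zero ⊖ e (suc zero)) ∷_) (trans (map-tabulate suc α)
  (sym (trans (cong (map (0ℤ ∷_)) (map-tabulate id α)) (map-tabulate α (0ℤ ∷_)))))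
  where
  α : ∀ {k} → Fin k → ℤ^ (suc k)
  α i = e (inject₁ i) ⊖ e (suc i)

simpleD-suc : ∀ k → simpleD (suc k) ≡ (e zero ⊖ e (suc zero)) ∷ map (0ℤ ∷_) (simpleD k)
simpleD-suc k = trans (cong (_∷ʳ (0ℤ ∷ last)) (differences-suc (suc k)))
  (cong ((e zero ⊖ e (suc zero)) ∷_) (sym (map-++ (0ℤ ∷_) (differences (suc k)) (last ∷ []))))
  where
  last : ℤ^ (suc (suc k))
  last = e (inject₁ (fromℕ k)) ⊕ e (suc (fromℕ k))

staircase : ∀ m → ℤ^ m
staircase zero    = []
staircase (suc m) = + m ∷ staircase m

0∷-∙ : ∀ {m} x (w v : ℤ^ m) → (x ∷ w) ∙ (0ℤ ∷ v) ≡ w ∙ v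
0∷-∙ x w v = trans (cong (_+ℤ w ∙ v) (ℤ.*-zeroʳ x)) (ℤ.+-identityˡ _)

staircase-positive : ∀ k → All (λ α → 0ℤ <ℤ staircase (suc (suc k)) ∙ α) (simpleD k)
staircase-positive zero    = +<+ (s≤s z≤n) ∷ +<+ (s≤s z≤n) ∷ []
staircase-positive (suc k) = subst (All (λ α → 0ℤ <ℤ h′ ∙ α)) (sym (simpleD-suc k))
  (subst (0ℤ <ℤ_) (sym head) (+<+ (s≤s z≤n))
    ∷ All.map⁺ (All.map (λ {β} → subst (0ℤ <ℤ_) (sym (0∷-∙ (+ suc (suc k)) h β))) (staircase-positive k)))
  where
  h  = staircase (suc (suc k))
  h′ = staircase (suc (suc (suc k)))
  head : h′ ∙ (e zero ⊖ e (suc zero)) ≡ 1ℤ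
  head = trans (∙-⊖ h′ (e zero) (e (suc zero)))
    (trans (cong₂ _-ℤ_ (∙-e h′ zero) (∙-e h′ (suc zero)))
           (solve 1 (λ x → (con 1ℤ :+ x) :- x := con 1ℤ) refl (+ suc k)))

D-suc-shellable : ∀ k → Shellable (antichains (D (suc (suc (suc k))))) → Shellable (antichains (D (suc (suc k))))
D-suc-shellable k = shift-shellable (simpleD k) ±e±e-shift⁺ ±e±e-shift⁻ ∘
  remove-simple (e₀ ⊖ e₁) ±e±e-≢0⃗ (zero , suc zero , Sign.+ , Sign.- , s≤s z≤n , ⊖≡ e₀ e₁)
    (subst (simpleD (suc k) ⊆ₗ_) (simpleD-suc k) id) (subst (_⊆ₗ simpleD (suc k)) (simpleD-suc k) id)
    e₀ (subst (0ℤ <ℤ_) (sym e₀∙α) (+<+ (s≤s z≤n)))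
    (All.map⁺ (All.tabulate λ {β} _ → trans (0∷-∙ 1ℤ 0⃗ β) (0⃗∙ β)))
    h (All.tail (subst (All (λ α → 0ℤ <ℤ h ∙ α)) (simpleD-suc k) (staircase-positive (suc k))))
  where
  e₀ e₁ h : ℤ^ (suc (suc (suc k)))
  e₀ = e zero
  e₁ = e (suc zero)
  h  = staircase (suc (suc (suc k)))
  ⊖≡ : ∀ {m} (u v : ℤ^ m) → u ⊖ v ≡ ± Sign.+ · u ⊕ ± Sign.- · v
  ⊖≡ []      []      = refl
  ⊖≡ (x ∷ u) (y ∷ v) = cong₂ _∷_ (cong₂ _+ℤ_ (sym (ℤ.*-identityˡ x)) (sym (ℤ.-1*i≡-i y))) (⊖≡ u v)
  e₀∙α : e₀ ∙ (e₀ ⊖ e₁) ≡ 1ℤ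
  e₀∙α = trans (∙-⊖ e₀ e₀ e₁) (cong₂ _-ℤ_ (∙-e e₀ zero) (∙-e e₀ (suc zero)))

D-¬shellable : ∀ n → 4 ℕ.≤ n → ¬ Shellable (antichains (D n))
D-¬shellable n 4≤n with ℕ.m≤n⇒∃[o]m+o≡n 4≤n
... | k , refl = go k
  where
  go : ∀ k → ¬ Shellable (antichains (D (4 ℕ.+ k)))
  go zero    = D₄-¬shellable
  go (suc k) = go k ∘ D-suc-shellable (2 ℕ.+ k)

halve : ∀ {m} → ℤ^ m → ℤ^ m
halve = Vec.map λ x → sign x ◃ ℕ.⌊ ∣ x ∣ /2⌋

Doubled : ∀ {m} → Pred (ℤ^ m) 0ℓ → Pred (ℤ^ m) 0ℓ
Doubled P v = P (halve v) × v ≡ + 2 · halve v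

Signs : ∀ {m} → Pred (ℤ^ m) 0ℓ
Signs v = v ≡ Vec.map ± (Vec.map sign v)

doubled⁺ : ∀ {m} {P : Pred (ℤ^ m) 0ℓ} {v} → Doubled P v → doubled P v
doubled⁺ (p , eq) = _ , p , eq

doubled? : ∀ {m} {P : Pred (ℤ^ m) 0ℓ} → Decidable P → Decidable (Doubled P)
doubled? P? v = P? (halve v) ×-dec (v ≟ᵥ (+ 2 · halve v))

signs? : ∀ {m} → Decidable (Signs {m})
signs? v = v ≟ᵥ Vec.map ± (Vec.map sign v)

±e? : ∀ {m} → Decidable (±e {m})
±e? v = Fin.any? λ i → anySign? λ s → v ≟ᵥ (± s · e i)

allSignVectors? : ∀ {m} {P : Pred (Vec Sign m) 0ℓ} → Decidable P → Dec (∀ s → P s)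
allSignVectors? {zero}  P? = map′ (λ p → λ { [] → p }) (λ f → f []) (P? [])
allSignVectors? {suc m} P? = map′ (λ f → λ { (s ∷ ss) → f s ss }) (λ f s ss → f (s ∷ ss))
  (allSigns? λ s → allSignVectors? λ ss → P? (s ∷ ss))

F₄-¬shellable : ¬ Shellable (antichains F₄)
F₄-¬shellable = coefficientsF₄-¬shellable ∘ coefficients-shellable
  ( ((+ 1 ∷ + 1 ∷ + 0 ∷ + 0 ∷ []) , +<+ (s≤s z≤n) , refl ∷ refl ∷ refl ∷ [])
  , ((+ 2 ∷ + 1 ∷ + 1 ∷ + 0 ∷ []) , +<+ (s≤s z≤n) , refl ∷ refl ∷ [])
  , ((+ 3 ∷ + 1 ∷ + 1 ∷ + 1 ∷ []) , +<+ (s≤s z≤n) , refl ∷ [])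
  , ((+ 1 ∷ + 0 ∷ + 0 ∷ + 0 ∷ []) , +<+ (s≤s z≤n) , [])
  , tt)
  (All.map isRoot (from-yes (all? (λ c → let v = linComb S c in
    doubled? ±e? v ⊎-dec doubled? ±e±e? v ⊎-dec signs? v) coefficientsF₄)))
  λ Φv → accounted-positive W (linComb S) coefficientsF₄ {S} (from-yes (nonNegative? W S)) (accounted Φv)
  where
  S = RootSystem.simple F₄
  W = (+ 1 ∷ + 1 ∷ + 0 ∷ + 0 ∷ []) ∷ (+ 2 ∷ + 1 ∷ + 1 ∷ + 0 ∷ [])
    ∷ (+ 3 ∷ + 1 ∷ + 1 ∷ + 1 ∷ []) ∷ (+ 1 ∷ + 0 ∷ + 0 ∷ + 0 ∷ []) ∷ []
  A? = accounted? W (linComb S) coefficientsF₄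
  isRoot : ∀ {v} → Doubled ±e v ⊎ Doubled ±e±e v ⊎ Signs v → RootSystem.Φ F₄ v
  isRoot (inj₁ p)        = inj₁ (doubled⁺ p)
  isRoot (inj₂ (inj₁ p)) = inj₂ (inj₁ (doubled⁺ p))
  isRoot (inj₂ (inj₂ p)) = inj₂ (inj₂ (_ , p))
  short : ∀ i s → Accounted W (linComb S) coefficientsF₄ (+ 2 · ± s · e i)
  short = from-yes (Fin.all? λ i → allSigns? λ s → A? (+ 2 · ± s · e i))
  long : ∀ i j s t → i Fin.< j → Accounted W (linComb S) coefficientsF₄ (+ 2 · (± s · e i ⊕ ± t · e j))
  long = from-yes (Fin.all? λ i → Fin.all? λ j → allSigns? λ s → allSigns? λ t →
    (i Fin.<? j) →-dec A? (+ 2 · (± s · e i ⊕ ± t · e j)))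
  half-integral : ∀ s → Accounted W (linComb S) coefficientsF₄ (Vec.map ± s)
  half-integral = from-yes (allSignVectors? λ s → A? (Vec.map ± s))
  accounted : ∀ {v} → RootSystem.Φ F₄ v → Accounted W (linComb S) coefficientsF₄ v
  accounted (inj₁ (_ , (i , s , refl) , refl))                             = short i s
  accounted (inj₂ (inj₁ (_ , (i , j , s , t , i<j , refl) , refl))) = long i j s t i<j
  accounted (inj₂ (inj₂ (s , refl)))                                       = half-integral s

simpleE : List (ℤ^ 8)
simpleE = RootSystem.simple E₈

-- The simple roots α₂, α₄, α₃, α₅ of E₈, which span a subsystem of type D₄ with central node α₄.
simpleE-D₄ : List (ℤ^ 8)
simpleE-D₄ =
    (+ 2 ∷ + 2 ∷ + 0 ∷ + 0 ∷ + 0 ∷ + 0 ∷ + 0 ∷ + 0 ∷ [])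
  ∷ (+ 0 ∷ - + 2 ∷ + 2 ∷ + 0 ∷ + 0 ∷ + 0 ∷ + 0 ∷ + 0 ∷ [])
  ∷ (- + 2 ∷ + 2 ∷ + 0 ∷ + 0 ∷ + 0 ∷ + 0 ∷ + 0 ∷ + 0 ∷ [])
  ∷ (+ 0 ∷ + 0 ∷ - + 2 ∷ + 2 ∷ + 0 ∷ + 0 ∷ + 0 ∷ + 0 ∷ [])
  ∷ []

ΦE₈ ΦE₇ ΦE₆ : Pred (ℤ^ 8) 0ℓ
ΦE₈ = RootSystem.Φ E₈
ΦE₇ = RootSystem.Φ E₇
ΦE₆ = RootSystem.Φ E₆

E₈Root E₇Root E₆Root : Pred (ℤ^ 8) 0ℓ
E₈Root v = Doubled ±e±e v ⊎ (signProduct (Vec.map sign v) ≡ Sign.+ × Signs v)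
E₇Root v = E₈Root v × Vec.lookup v (# 6) +ℤ Vec.lookup v (# 7) ≡ 0ℤ
E₆Root v = E₇Root v × Vec.lookup v (# 5) +ℤ Vec.lookup v (# 7) ≡ 0ℤ

e₈root? : Decidable E₈Root
e₈root? v = doubled? ±e±e? v ⊎-dec ((signProduct (Vec.map sign v) Sign.≟ Sign.+) ×-dec signs? v)

e₇root? : Decidable E₇Root
e₇root? v = e₈root? v ×-dec (Vec.lookup v (# 6) +ℤ Vec.lookup v (# 7) ≟ℤ 0ℤ)

e₆root? : Decidable E₆Root
e₆root? v = e₇root? v ×-dec (Vec.lookup v (# 5) +ℤ Vec.lookup v (# 7) ≟ℤ 0ℤ)

isE₈Root : ∀ {v} → E₈Root v → ΦE₈ v
isE₈Root (inj₁ p)       = inj₁ (doubled⁺ p)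
isE₈Root (inj₂ (p , q)) = inj₂ (_ , p , q)

isE₇Root : ∀ {v} → E₇Root v → ΦE₇ v
isE₇Root (p , q) = isE₈Root p , q

isE₆Root : ∀ {v} → E₆Root v → ΦE₆ v
isE₆Root (p , q) = isE₇Root p , q

E₈-≢0⃗ : ∀ {v} → ΦE₈ v → v ≢ 0⃗
E₈-≢0⃗ (inj₁ (w , p , refl))        eq = ±e±e-≢0⃗ p (halve-≡0 w eq)
  where
  halve-≡0 : ∀ {m} (w : ℤ^ m) → + 2 · w ≡ 0⃗ → w ≡ 0⃗
  halve-≡0 []      _  = refl
  halve-≡0 (x ∷ w) eq = cong₂ _∷_ (ℤ.*-cancelˡ-≡ (+ 2) x 0ℤ (Vec.∷-injectiveˡ eq)) (halve-≡0 w (Vec.∷-injectiveʳ eq))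
E₈-≢0⃗ (inj₂ (s ∷ _ , _ , refl)) eq = ±≢0 s (Vec.∷-injectiveˡ eq)

module _ {Φ : Pred (ℤ^ 8) 0ℓ} (⊆E₈ : ∀ {v} → Φ v → ΦE₈ v) (roots : All (Φ ∘ linComb simpleE-D₄) coefficientsD₄) where

  E-D₄-¬shellable : ¬ Shellable (antichains (rootSystem Φ simpleE-D₄))
  E-D₄-¬shellable = coefficientsD₄-¬shellable ∘ coefficients-shellable
    ( ((+ 1 ∷ + 1 ∷ + 1 ∷ + 1 ∷ + 0 ∷ + 0 ∷ + 0 ∷ + 0 ∷ []) , +<+ (s≤s z≤n) , refl ∷ refl ∷ refl ∷ [])
    , ((+ 0 ∷ + 0 ∷ + 1 ∷ + 1 ∷ + 0 ∷ + 0 ∷ + 0 ∷ + 0 ∷ []) , +<+ (s≤s z≤n) , refl ∷ refl ∷ [])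
    , ((-1ℤ ∷ + 1 ∷ + 1 ∷ + 1 ∷ + 0 ∷ + 0 ∷ + 0 ∷ + 0 ∷ []) , +<+ (s≤s z≤n) , refl ∷ [])
    , ((+ 0 ∷ + 0 ∷ + 0 ∷ + 1 ∷ + 0 ∷ + 0 ∷ + 0 ∷ + 0 ∷ []) , +<+ (s≤s z≤n) , [])
    , tt)
    roots
    λ Φv → accounted-positive W (linComb simpleE-D₄) coefficientsD₄ {simpleE-D₄}
      (from-yes (nonNegative? W simpleE-D₄)) (accounted (⊆E₈ Φv))
    where
    W = (+ 1 ∷ + 1 ∷ + 1 ∷ + 1 ∷ + 0 ∷ + 0 ∷ + 0 ∷ + 0 ∷ [])
      ∷ (+ 0 ∷ + 0 ∷ + 1 ∷ + 1 ∷ + 0 ∷ + 0 ∷ + 0 ∷ + 0 ∷ [])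
      ∷ (-1ℤ ∷ + 1 ∷ + 1 ∷ + 1 ∷ + 0 ∷ + 0 ∷ + 0 ∷ + 0 ∷ [])
      ∷ (+ 0 ∷ + 0 ∷ + 0 ∷ + 1 ∷ + 0 ∷ + 0 ∷ + 0 ∷ + 0 ∷ [])
      ∷ e (# 4) ∷ -1ℤ · e (# 4) ∷ e (# 5) ∷ -1ℤ · e (# 5)
      ∷ e (# 6) ∷ -1ℤ · e (# 6) ∷ e (# 7) ∷ -1ℤ · e (# 7) ∷ []
    A? = accounted? W (linComb simpleE-D₄) coefficientsD₄
    integral : ∀ i j s t → i Fin.< j → Accounted W (linComb simpleE-D₄) coefficientsD₄ (+ 2 · (± s · e i ⊕ ± t · e j))
    integral = from-yes (Fin.all? λ i → Fin.all? λ j → allSigns? λ s → allSigns? λ t →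
      (i Fin.<? j) →-dec A? (+ 2 · (± s · e i ⊕ ± t · e j)))
    half-integral : ∀ s → Accounted W (linComb simpleE-D₄) coefficientsD₄ (Vec.map ± s)
    half-integral = from-yes (allSignVectors? λ s → A? (Vec.map ± s))
    accounted : ∀ {v} → ΦE₈ v → Accounted W (linComb simpleE-D₄) coefficientsD₄ v
    accounted (inj₁ (_ , (i , j , s , t , i<j , refl) , refl)) = integral i j s t i<j
    accounted (inj₂ (s , _ , refl))                              = half-integral s

-- ρ∨ pairs to 2 with every simple root.
α₁ α₆ α₇ α₈ ρ∨ : ℤ^ 8
α₁ = + 1 ∷ - + 1 ∷ - + 1 ∷ - + 1 ∷ - + 1 ∷ - + 1 ∷ - + 1 ∷ + 1 ∷ []
α₆ = + 0 ∷ + 0 ∷ + 0 ∷ - + 2 ∷ + 2 ∷ + 0 ∷ + 0 ∷ + 0 ∷ []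
α₇ = + 0 ∷ + 0 ∷ + 0 ∷ + 0 ∷ - + 2 ∷ + 2 ∷ + 0 ∷ + 0 ∷ []
α₈ = + 0 ∷ + 0 ∷ + 0 ∷ + 0 ∷ + 0 ∷ - + 2 ∷ + 2 ∷ + 0 ∷ []
ρ∨ = + 0 ∷ + 1 ∷ + 2 ∷ + 3 ∷ + 4 ∷ + 5 ∷ + 6 ∷ + 23 ∷ []

module _ {Φ : Pred (ℤ^ 8) 0ℓ} (⊆E₈ : ∀ {v} → Φ v → ΦE₈ v) (roots : All (Φ ∘ linComb simpleE-D₄) coefficientsD₄)
         (Φα₁ : Φ α₁) (Φα₆ : Φ α₆) where

  simple₆-¬shellable : ¬ Shellable (antichains (rootSystem Φ (take 6 simpleE)))
  simple₆-¬shellable = E-D₄-¬shellable ⊆E₈ roots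
    ∘ remove-simple-dec {S = take 5 simpleE} α₁ (e (# 7)) ρ∨ (E₈-≢0⃗ ∘ ⊆E₈) Φα₁
    ∘ remove-simple-dec {S = take 6 simpleE} α₆ (e (# 4) ⊕ e (# 7)) ρ∨ (E₈-≢0⃗ ∘ ⊆E₈) Φα₆

  simple₇-¬shellable : Φ α₇ → ¬ Shellable (antichains (rootSystem Φ (take 7 simpleE)))
  simple₇-¬shellable Φα₇ = simple₆-¬shellable
    ∘ remove-simple-dec {S = take 7 simpleE} α₇ (e (# 5) ⊕ e (# 7)) ρ∨ (E₈-≢0⃗ ∘ ⊆E₈) Φα₇

  simple₈-¬shellable : Φ α₇ → Φ α₈ → ¬ Shellable (antichains (rootSystem Φ simpleE))
  simple₈-¬shellable Φα₇ Φα₈ = simple₇-¬shellable Φα₇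
    ∘ remove-simple-dec {S = simpleE} α₈ (e (# 6) ⊕ e (# 7)) ρ∨ (E₈-≢0⃗ ∘ ⊆E₈) Φα₈

E₆-¬shellable : ¬ Shellable (antichains E₆)
E₆-¬shellable = simple₆-¬shellable {ΦE₆} (proj₁ ∘ proj₁)
  (All.map isE₆Root (from-yes (all? (e₆root? ∘ linComb simpleE-D₄) coefficientsD₄)))
  (isE₆Root (from-yes (e₆root? α₁))) (isE₆Root (from-yes (e₆root? α₆)))

E₇-¬shellable : ¬ Shellable (antichains E₇)
E₇-¬shellable = simple₇-¬shellable {ΦE₇} proj₁
  (All.map isE₇Root (from-yes (all? (e₇root? ∘ linComb simpleE-D₄) coefficientsD₄)))
  (isE₇Root (from-yes (e₇root? α₁))) (isE₇Root (from-yes (e₇root? α₆))) (isE₇Root (from-yes (e₇root? α₇)))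

E₈-¬shellable : ¬ Shellable (antichains E₈)
E₈-¬shellable = simple₈-¬shellable {ΦE₈} id
  (All.map isE₈Root (from-yes (all? (e₈root? ∘ linComb simpleE-D₄) coefficientsD₄)))
  (isE₈Root (from-yes (e₈root? α₁))) (isE₈Root (from-yes (e₈root? α₆)))
  (isE₈Root (from-yes (e₈root? α₇))) (isE₈Root (from-yes (e₈root? α₈)))

-- Types D₃, G₂, A and B

module Chain {m} {Φ : Pred (ℤ^ m) 0ℓ} {S : List (ℤ^ m)} (E : ℕ → ℤ^ m) (N : ℕ) (U : List ℕ²) where

  root : ℕ² → ℤ^ m
  root (i , j) = E j ⊖ E i

  module _ (step : ∀ {j} → j < N → E (suc j) ⊖ E j ∈ℕ⟨ S ⟩)
           (bounded : ∀ {i j} → (i , j) ∈ U → i ≤ j × j ≤ N)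
           (∧-closed : ∀ {p q} → p ∈ U → q ∈ U → p ∧ q ∈ U)
           (isRoot : ∀ {p} → p ∈ U → Φ (root p))
           (complete : ∀ {v} → Φ v → v ∈ℕ⟨ S ⟩ → ∃ λ p → p ∈ U × v ≡ root p)
           (reflects : ∀ {p q} → p ∈ U → q ∈ U → root q ⊖ root p ∈ℕ⟨ S ⟩ → p ⊑ q) where

    private
      rise : ∀ {i j} → i ≤ j → j ≤ N → E j ⊖ E i ∈ℕ⟨ S ⟩
      rise {i} {j} i≤j j≤N with ℕ.≤⇒≤′ i≤j
      ... | ℕ.≤′-refl = subst (_∈ℕ⟨ S ⟩) (sym (⊖-self (E i))) (0⃗∈ S)
      ... | ℕ.≤′-step {j′} i≤′j = subst (_∈ℕ⟨ S ⟩) (⊖-⊕-⊖ (E j) (E j′) (E i))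
        (⊕-∈ S (step j≤N) (rise (ℕ.≤′⇒≤ i≤′j) (ℕ.<⇒≤ j≤N)))

      positive : ∀ {p} → p ∈ U → root p ∈ℕ⟨ S ⟩
      positive p∈ = let i≤j , j≤N = bounded p∈ in rise i≤j j≤N

      root-mono : ∀ {p q} → p ∈ U → q ∈ U → p ⊑ q → root q ⊖ root p ∈ℕ⟨ S ⟩
      root-mono {i , j} {k , l} p∈ q∈ (k≤i , j≤l) =
        subst (_∈ℕ⟨ S ⟩) (sym (⊖-⊖-⊖ (E l) (E k) (E j) (E i)))
          (⊕-∈ S (rise j≤l (proj₂ (bounded q∈)))
                 (rise k≤i (let i≤j , j≤N = bounded p∈ in ℕ.≤-trans i≤j j≤N)))

      root-injective : ∀ {p q} → p ∈ U → q ∈ U → root p ≡ root q → p ≡ q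
      root-injective p∈ q∈ eq = ⊑-antisym (reflects p∈ q∈ (zero-diff (sym eq))) (reflects q∈ p∈ (zero-diff eq))
        where
        zero-diff : ∀ {u v} → u ≡ v → u ⊖ v ∈ℕ⟨ S ⟩
        zero-diff {u} refl = subst (_∈ℕ⟨ S ⟩) (sym (⊖-self u)) (0⃗∈ S)

      locate : ℤ^ m → ℕ²
      locate v with any? (λ p → v ≟ᵥ root p) U
      ... | yes found = proj₁ (find found)
      ... | no  _     = 0 , 0

      locate-root : ∀ {p} → p ∈ U → locate (root p) ≡ p
      locate-root {p} p∈ with any? (λ q → root p ≟ᵥ root q) U
      ... | yes found = let _ , q∈ , eq = find found in root-injective q∈ p∈ (sym eq)
      ... | no  none  = contradiction (lose p∈ refl) none

    chain-shellable : Shellable (antichains (rootSystem Φ S))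
    chain-shellable = link-shellable {ρ = []} {ι = locate} (isLink record
      { refl-≤       = λ _ → ℕ.≤-refl , ℕ.≤-refl
      ; base         = (λ ()) , λ ()
      ; into         = λ (Φv , v∈) → into (complete Φv v∈)
      ; mono         = λ (Φu , u∈) (Φv , v∈) → mono (complete Φu u∈) (complete Φv v∈)
      ; reflect      = λ (Φu , u∈) (Φv , v∈) → reflect (complete Φu u∈) (complete Φv v∈)
      ; injective    = λ (Φu , u∈) (Φv , v∈) → injective (complete Φu u∈) (complete Φv v∈)
      ; incomparable = λ ()
      ; covers       = λ {p} p∈ _ → inj₂ (root p , (isRoot p∈ , positive p∈) , sym (locate-root p∈))
      }) (Planar.planar-shellable U ∧-closed)
      where
      Located : ℤ^ m → Set
      Located v = ∃ λ p → p ∈ U × v ≡ root p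
      into : ∀ {v} → Located v → locate v ∈ U
      into (p , p∈ , refl) = subst (_∈ U) (sym (locate-root p∈)) p∈
      mono : ∀ {u v} → Located u → Located v → v ⊖ u ∈ℕ⟨ S ⟩ → locate u ⊑ locate v
      mono (p , p∈ , refl) (q , q∈ , refl) d∈ =
        subst₂ _⊑_ (sym (locate-root p∈)) (sym (locate-root q∈)) (reflects p∈ q∈ d∈)
      reflect : ∀ {u v} → Located u → Located v → locate u ⊑ locate v → v ⊖ u ∈ℕ⟨ S ⟩
      reflect (p , p∈ , refl) (q , q∈ , refl) p⊑q =
        root-mono p∈ q∈ (subst₂ _⊑_ (locate-root p∈) (locate-root q∈) p⊑q)
      injective : ∀ {u v} → Located u → Located v → locate u ≡ locate v → u ≡ v
      injective (p , p∈ , refl) (q , q∈ , refl) eq =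
        cong root (trans (sym (locate-root p∈)) (trans eq (locate-root q∈)))

  module _ (W : List (ℤ^ m)) where

    Reflects : Set
    Reflects = All (λ p → All (λ q → p ⊑ q ⊎ Negative W (root q ⊖ root p)) U) U

    reflects? : Dec Reflects
    reflects? = all? (λ p → all? (λ q → p ⊑? q ⊎-dec negative? W (root q ⊖ root p)) U) U

    reflects-by : NonNegative W S → Reflects → ∀ {p q} → p ∈ U → q ∈ U → root q ⊖ root p ∈ℕ⟨ S ⟩ → p ⊑ q
    reflects-by nonneg r p∈ q∈ d∈ =
      [ id , (λ neg → contradiction d∈ (negative⇒∉ℕ {S = S} nonneg neg)) ]′ (All.lookup (All.lookup r p∈) q∈)

module _ (U : List ℕ²) where

  bounded? : ∀ N → Dec (All (λ (i , j) → i ≤ j × j ≤ N) U)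
  bounded? N = all? (λ (i , j) → (i ℕ.≤? j) ×-dec (j ℕ.≤? N)) U

  ∧-closed? : Dec (All (λ p → All (λ q → p ∧ q ∈ U) U) U)
  ∧-closed? = all? (λ p → all? (λ q → p ∧ q ∈²? U) U) U

D₃-shellable : Shellable (antichains (D 3))
D₃-shellable = chain-shellable step (All.lookup (from-yes (bounded? U 3)))
  (λ p∈ q∈ → All.lookup (All.lookup (from-yes (∧-closed? U)) p∈) q∈)
  (All.lookup (from-yes (all? (±e±e? ∘ root) U)))
  (λ { (i , j , s , t , i<j , refl) → accounted-positive W root U {S} nonneg (located i j s t i<j) })
  (reflects-by W nonneg (from-yes (reflects? W)))
  where
  E : ℕ → ℤ^ 3
  E 1 = + 0 ∷ + 1 ∷ -1ℤ ∷ []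
  E 2 = + 1 ∷ + 0 ∷ -1ℤ ∷ []
  E 3 = + 1 ∷ + 1 ∷ + 0 ∷ []
  E _ = 0⃗
  U = (0 , 1) ∷ (0 , 2) ∷ (0 , 3) ∷ (1 , 2) ∷ (1 , 3) ∷ (2 , 3) ∷ []
  W = (+ 1 ∷ + 0 ∷ + 0 ∷ []) ∷ (+ 1 ∷ + 1 ∷ -1ℤ ∷ []) ∷ (+ 1 ∷ + 1 ∷ + 1 ∷ []) ∷ []
  S = RootSystem.simple (D 3)
  open Chain {Φ = ±e±e} {S = S} E 3 U
  nonneg = from-yes (nonNegative? W S)
  step : ∀ {j} → j < 3 → E (suc j) ⊖ E j ∈ℕ⟨ S ⟩
  step {0} _ = generator-∈ (there (here refl))
  step {1} _ = generator-∈ (here refl)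
  step {2} _ = generator-∈ (there (there (here refl)))
  step {suc (suc (suc _))} (s≤s (s≤s (s≤s ())))
  located : ∀ i j s t → i Fin.< j → Accounted W root U (± s · e i ⊕ ± t · e j)
  located = from-yes (Fin.all? λ i → Fin.all? λ j → allSigns? λ s → allSigns? λ t →
    (i Fin.<? j) →-dec accounted? W root U (± s · e i ⊕ ± t · e j))

G₂-shellable : Shellable (antichains G₂)
G₂-shellable = chain-shellable step (All.lookup (from-yes (bounded? U 5)))
  (λ p∈ q∈ → All.lookup (All.lookup (from-yes (∧-closed? U)) p∈) q∈)
  (All.lookup (from-yes (all? (λ p → short? (root p) ⊎-dec long? (root p)) U)))
  (λ Φv → accounted-positive W root U {S} nonneg (located Φv))
  (reflects-by W nonneg (from-yes (reflects? W)))
  where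
  E : ℕ → ℤ^ 3
  E 1 = + 1 ∷ -1ℤ ∷ + 0 ∷ []
  E 2 = -1ℤ ∷ + 0 ∷ + 1 ∷ []
  E 3 = + 0 ∷ -1ℤ ∷ + 1 ∷ []
  E 4 = + 1 ∷ - + 2 ∷ + 1 ∷ []
  E 5 = -1ℤ ∷ -1ℤ ∷ + 2 ∷ []
  E _ = 0⃗
  U = (0 , 1) ∷ (1 , 2) ∷ (0 , 2) ∷ (0 , 3) ∷ (0 , 4) ∷ (0 , 5) ∷ []
  W = (+ 0 ∷ -1ℤ ∷ + 1 ∷ []) ∷ (+ 0 ∷ + 0 ∷ + 1 ∷ []) ∷ []
  S = RootSystem.simple G₂
  open Chain {Φ = RootSystem.Φ G₂} {S = S} E 5 U
  nonneg = from-yes (nonNegative? W S)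
  step : ∀ {j} → j < 5 → E (suc j) ⊖ E j ∈ℕ⟨ S ⟩
  step {0} _ = generator-∈ (here refl)
  step {1} _ = generator-∈ (there (here refl))
  step {2} _ = generator-∈ (here refl)
  step {3} _ = generator-∈ (here refl)
  step {4} _ = generator-∈ (there (here refl))
  step {suc (suc (suc (suc (suc _))))} (s≤s (s≤s (s≤s (s≤s (s≤s ())))))
  short? : ∀ v → Dec (∃ λ i → ∃ λ j → i ≢ j × v ≡ e i ⊖ e j)
  short? v = Fin.any? λ i → Fin.any? λ j → ¬? (i Fin.≟ j) ×-dec (v ≟ᵥ (e i ⊖ e j))
  longRoot : Fin 3 → Fin 3 → Fin 3 → Sign → ℤ^ 3
  longRoot i j k s = ± s · (+ 2 · e i ⊖ e j ⊖ e k)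
  long? : ∀ v → Dec (∃ λ i → ∃ λ j → ∃ λ k → ∃ λ s → i ≢ j × j ≢ k × i ≢ k × v ≡ longRoot i j k s)
  long? v = Fin.any? λ i → Fin.any? λ j → Fin.any? λ k → anySign? λ s →
    ¬? (i Fin.≟ j) ×-dec ¬? (j Fin.≟ k) ×-dec ¬? (i Fin.≟ k) ×-dec (v ≟ᵥ longRoot i j k s)
  located : ∀ {v} → RootSystem.Φ G₂ v → Accounted W root U v
  located (inj₁ (i , j , i≢j , refl)) = from-yes (Fin.all? λ i → Fin.all? λ j →
    ¬? (i Fin.≟ j) →-dec accounted? W root U (e i ⊖ e j)) i j i≢j
  located (inj₂ (i , j , k , s , i≢j , j≢k , i≢k , refl)) = from-yes
    (Fin.all? λ i → Fin.all? λ j → Fin.all? λ k → allSigns? λ s →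
      ¬? (i Fin.≟ j) →-dec ¬? (j Fin.≟ k) →-dec ¬? (i Fin.≟ k) →-dec accounted? W root U (longRoot i j k s))
    i j k s i≢j j≢k i≢k

unit : ∀ {m} → ℕ → ℤ^ m
unit {zero}  _       = []
unit {suc m} zero    = 1ℤ ∷ 0⃗
unit {suc m} (suc j) = 0ℤ ∷ unit j

unit-toℕ : ∀ {m} (i : Fin m) → unit (toℕ i) ≡ e i
unit-toℕ zero    = refl
unit-toℕ (suc i) = cong (0ℤ ∷_) (unit-toℕ i)

unit-fromℕ< : ∀ {m j} (j<m : j < m) → unit j ≡ e (fromℕ< j<m)
unit-fromℕ< {m} j<m = trans (cong unit (sym (Fin.toℕ-fromℕ< j<m))) (unit-toℕ (fromℕ< j<m))

unit-beyond : ∀ {m j} → m ≤ j → unit {m} j ≡ 0⃗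
unit-beyond {zero}          _         = refl
unit-beyond {suc m} {suc j} (s≤s m≤j) = cong (0ℤ ∷_) (unit-beyond m≤j)

prefix : ∀ {m} → ℕ → ℤ^ m
prefix {zero}  _       = []
prefix {suc m} zero    = 1ℤ ∷ 0⃗
prefix {suc m} (suc r) = 1ℤ ∷ prefix r

ind : ℕ → ℕ → ℤ
ind zero    _       = 1ℤ
ind (suc j) zero    = 0ℤ
ind (suc j) (suc r) = ind j r

ind-≤ : ∀ {j r} → j ≤ r → ind j r ≡ 1ℤ
ind-≤ z≤n       = refl
ind-≤ (s≤s j≤r) = ind-≤ j≤r

ind-> : ∀ {j r} → r < j → ind j r ≡ 0ℤ
ind-> {suc j} {zero}  _         = refl
ind-> {suc j} {suc r} (s≤s r<j) = ind-> r<j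

0≤ind : ∀ j r → 0ℤ ≤ℤ ind j r
0≤ind zero    _       = +≤+ z≤n
0≤ind (suc j) zero    = +≤+ z≤n
0≤ind (suc j) (suc r) = 0≤ind j r

ind≤1 : ∀ j r → ind j r ≤ℤ 1ℤ
ind≤1 zero    _       = +≤+ (s≤s z≤n)
ind≤1 (suc j) zero    = +≤+ z≤n
ind≤1 (suc j) (suc r) = ind≤1 j r

ind-anti : ∀ j r → ind (suc j) r ≤ℤ ind j r
ind-anti zero    zero    = +≤+ z≤n
ind-anti zero    (suc r) = ℤ.≤-refl
ind-anti (suc j) zero    = +≤+ z≤n
ind-anti (suc j) (suc r) = ind-anti j r

prefix-unit : ∀ {m r} j → r < m → prefix {m} r ∙ unit j ≡ ind j r
prefix-unit {suc m} {zero}  zero    _ rewrite ∙-0⃗ (0⃗ {m}) = refl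
prefix-unit {suc m} {zero}  (suc j) _ = trans (0∷-∙ 1ℤ 0⃗ (unit {m} j)) (0⃗∙ (unit {m} j))
prefix-unit {suc m} {suc r} zero    _ rewrite ∙-0⃗ (prefix {m} r) = refl
prefix-unit {suc m} {suc r} (suc j) (s≤s r<m) = trans (0∷-∙ 1ℤ (prefix r) (unit {m} j)) (prefix-unit j r<m)

prefix-e : ∀ {m r} (i : Fin m) → r < m → prefix r ∙ e i ≡ ind (toℕ i) r
prefix-e {r = r} i r<m = trans (cong (prefix r ∙_) (sym (unit-toℕ i))) (prefix-unit (toℕ i) r<m)

difference-∈ : ∀ {k j} → j < k → unit j ⊖ unit (suc j) ∈ differences k
difference-∈ {k} {j} j<k = subst (_∈ differences k) (cong₂ _⊖_ first second) (∈-map⁺ _ (∈-allFin i))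
  where
  i = fromℕ< j<k
  first : e (inject₁ i) ≡ unit j
  first = trans (sym (unit-toℕ (inject₁ i))) (cong unit (trans (Fin.toℕ-inject₁ i) (Fin.toℕ-fromℕ< j<k)))
  second : e (suc i) ≡ unit (suc j)
  second = trans (sym (unit-toℕ (suc i))) (cong unit (cong suc (Fin.toℕ-fromℕ< j<k)))

prefix-differences : ∀ {k r} → r < suc k → All (λ α → 0ℤ ≤ℤ prefix r ∙ α) (differences k)
prefix-differences {k} {r} r<m = All.map⁺ (All.tabulate λ {i} _ → subst (0ℤ ≤ℤ_) (sym (value i))
  (ℤ.i≤j⇒0≤j-i (ind-anti (toℕ i) r)))
  where
  value : ∀ (i : Fin k) → prefix r ∙ (e (inject₁ i) ⊖ e (suc i)) ≡ ind (toℕ i) r -ℤ ind (suc (toℕ i)) r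
  value i = trans (∙-⊖ (prefix r) (e (inject₁ i)) (e (suc i)))
    (cong₂ _-ℤ_ (trans (prefix-e (inject₁ i) r<m) (cong (λ n → ind n r) (Fin.toℕ-inject₁ i))) (prefix-e (suc i) r<m))

0⃗⊖-⊖-0⃗⊖ : ∀ {m} (u v : ℤ^ m) → (0⃗ ⊖ u) ⊖ (0⃗ ⊖ v) ≡ v ⊖ u
0⃗⊖-⊖-0⃗⊖ []      []      = refl
0⃗⊖-⊖-0⃗⊖ (x ∷ u) (y ∷ v) =
  cong₂ _∷_ (solve 2 (λ x y → (con 0ℤ :- x) :- (con 0ℤ :- y) := y :- x) refl x y) (0⃗⊖-⊖-0⃗⊖ u v)

1≰0 : ¬ (1ℤ ≤ℤ 0ℤ)
1≰0 (+≤+ ())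

A-shellable : ∀ n → Shellable (antichains (A n))
A-shellable n = chain-shellable step bounded ∧-closed isRoot complete reflects
  where
  S = differences n
  E : ℕ → ℤ^ (suc n)
  E j = 0⃗ ⊖ unit j
  inRange? : Decidable (λ (p : ℕ²) → proj₁ p < proj₂ p)
  inRange? (i , j) = i ℕ.<? j
  U = filter inRange? (cartesianProduct (upTo (suc n)) (upTo (suc n)))
  ∈U⁻ : ∀ {i j} → (i , j) ∈ U → i < j × j ≤ n
  ∈U⁻ p∈ with ∈-filter⁻ inRange? {xs = cartesianProduct (upTo (suc n)) (upTo (suc n))} p∈
  ... | p∈′ , i<j = i<j , ℕ.≤-pred (∈-upTo⁻ (proj₂ (∈-cartesianProduct⁻ (upTo (suc n)) (upTo (suc n)) p∈′)))
  ∈U⁺ : ∀ {i j} → i < j → j ≤ n → (i , j) ∈ U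
  ∈U⁺ i<j j≤n = ∈-filter⁺ inRange?
    (∈-cartesianProduct⁺ (∈-upTo⁺ (s≤s (ℕ.≤-trans (ℕ.<⇒≤ i<j) j≤n))) (∈-upTo⁺ (s≤s j≤n))) i<j
  open Chain {Φ = RootSystem.Φ (A n)} {S = S} E n U
  root-e : ∀ i j → root (i , j) ≡ unit i ⊖ unit j
  root-e i j = 0⃗⊖-⊖-0⃗⊖ (unit j) (unit i)
  step : ∀ {j} → j < n → E (suc j) ⊖ E j ∈ℕ⟨ S ⟩
  step {j} j<n = subst (_∈ℕ⟨ S ⟩) (sym (0⃗⊖-⊖-0⃗⊖ (unit (suc j)) (unit j))) (generator-∈ (difference-∈ j<n))
  bounded : ∀ {i j} → (i , j) ∈ U → i ≤ j × j ≤ n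
  bounded p∈ = let i<j , j≤n = ∈U⁻ p∈ in ℕ.<⇒≤ i<j , j≤n
  ∧-closed : ∀ {p q} → p ∈ U → q ∈ U → p ∧ q ∈ U
  ∧-closed {i , j} {k , l} p∈ q∈ = let i<j , j≤n = ∈U⁻ p∈ ; k<l , _ = ∈U⁻ q∈ in
    ∈U⁺ (ℕ.⊓-mono-< i<j k<l) (ℕ.≤-trans (ℕ.m⊓n≤m j l) j≤n)
  isRoot : ∀ {p} → p ∈ U → RootSystem.Φ (A n) (root p)
  isRoot {i , j} p∈ with ∈U⁻ p∈
  ... | i<j , j≤n = fromℕ< i<m , fromℕ< (s≤s j≤n) ,
      (λ eq → ℕ.<⇒≢ i<j (Fin.fromℕ<-injective i j i<m (s≤s j≤n) eq)) ,
      trans (root-e i j) (cong₂ _⊖_ (unit-fromℕ< i<m) (unit-fromℕ< (s≤s j≤n)))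
    where i<m = s≤s (ℕ.≤-trans (ℕ.<⇒≤ i<j) j≤n)
  prefix-root : ∀ {r} i j → r < suc n → prefix r ∙ root (i , j) ≡ ind i r -ℤ ind j r
  prefix-root {r} i j r<m = trans (cong (prefix r ∙_) (root-e i j)) (trans (∙-⊖ {suc n} (prefix r) (unit i) (unit j))
    (cong₂ _-ℤ_ (prefix-unit i r<m) (prefix-unit j r<m)))
  complete : ∀ {v} → RootSystem.Φ (A n) v → v ∈ℕ⟨ S ⟩ → ∃ λ p → p ∈ U × v ≡ root p
  complete (i , j , i≢j , refl) v∈ with ℕ.<-cmp (toℕ i) (toℕ j)
  ... | tri< i<j _ _ = (toℕ i , toℕ j) , ∈U⁺ i<j (ℕ.≤-pred (Fin.toℕ<n j))
      , sym (trans (root-e (toℕ i) (toℕ j)) (cong₂ _⊖_ (unit-toℕ i) (unit-toℕ j)))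
  ... | tri≈ _ i≡j _ = contradiction (Fin.toℕ-injective i≡j) i≢j
  ... | tri> _ _ j<i = contradiction
      (subst (0ℤ ≤ℤ_) value (∙-nonneg {S = S} (prefix (toℕ j)) (prefix-differences (Fin.toℕ<n j)) v∈)) λ ()
    where
    value : prefix (toℕ j) ∙ (e i ⊖ e j) ≡ -1ℤ
    value = trans (∙-⊖ (prefix (toℕ j)) (e i) (e j)) (cong₂ _-ℤ_
      (trans (prefix-e i (Fin.toℕ<n j)) (ind-> j<i)) (trans (prefix-e j (Fin.toℕ<n j)) (ind-≤ {toℕ j} ℕ.≤-refl)))
  reflects : ∀ {p q} → p ∈ U → q ∈ U → root q ⊖ root p ∈ℕ⟨ S ⟩ → p ⊑ q
  reflects {i , j} {k , l} p∈ q∈ d∈ with ∈U⁻ p∈ | ∈U⁻ q∈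
  ... | i<j , j≤n | k<l , l≤n = ℕ.≮⇒≥ i≮k , ℕ.≮⇒≥ l≮j
    where
    compare : ∀ {r} → r < suc n → ind i r -ℤ ind j r ≤ℤ ind k r -ℤ ind l r
    compare {r} r<m = ℤ.0≤i-j⇒j≤i (subst (0ℤ ≤ℤ_)
      (trans (∙-⊖ (prefix r) (root (k , l)) (root (i , j))) (cong₂ _-ℤ_ (prefix-root k l r<m) (prefix-root i j r<m)))
      (∙-nonneg {S = S} (prefix r) (prefix-differences r<m) d∈))
    i≮k : ¬ (i < k)
    i≮k i<k = 1≰0 (subst₂ _≤ℤ_ (cong₂ _-ℤ_ (ind-≤ {i} ℕ.≤-refl) (ind-> i<j))
      (cong₂ _-ℤ_ (ind-> i<k) (ind-> (ℕ.<-trans i<k k<l))) (compare (s≤s (ℕ.≤-trans (ℕ.<⇒≤ i<j) j≤n))))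
    l≮j : ¬ (l < j)
    l≮j (s≤s {n = r} l≤r) = 1≰0 (ℤ.≤-trans (subst (_≤ℤ ind k r -ℤ ind l r)
        (cong₂ _-ℤ_ (ind-≤ (ℕ.≤-pred i<j)) (ind-> {suc r} ℕ.≤-refl)) (compare (s≤s (ℕ.≤-trans (ℕ.n≤1+n r) j≤n))))
      (subst (λ x → ind k r -ℤ x ≤ℤ 0ℤ) (sym (ind-≤ l≤r)) (ℤ.i≤j⇒i-j≤0 (ind≤1 k r))))

simpleB : ∀ k → List (ℤ^ (suc k))
simpleB k = RootSystem.simple (B (suc k))

prefix-simpleB : ∀ {k r} → r < suc k → All (λ α → 0ℤ ≤ℤ prefix r ∙ α) (simpleB k)
prefix-simpleB {k} {r} r<n = All.++⁺ (prefix-differences r<n)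
  (subst (0ℤ ≤ℤ_) (sym (prefix-e (fromℕ k) r<n)) (0≤ind (toℕ (fromℕ k)) r) ∷ [])

unit-step-∈ : ∀ k j → unit j ⊖ unit (suc j) ∈ℕ⟨ simpleB k ⟩
unit-step-∈ k j with ℕ.<-cmp j k
... | tri< j<k _ _  = generator-∈ (∈-++⁺ˡ (difference-∈ j<k))
... | tri≈ _ refl _ = subst (_∈ℕ⟨ simpleB k ⟩)
  (trans (sym (⊖-0⃗ (e (fromℕ k)))) (cong₂ _⊖_ (trans (sym (unit-toℕ (fromℕ k))) (cong unit (Fin.toℕ-fromℕ k)))
                                           (sym (unit-beyond {suc k} {suc k} ℕ.≤-refl))))
  (generator-∈ (∈-++⁺ʳ (differences k) (here refl)))
  where
  ⊖-0⃗ : ∀ {m} (v : ℤ^ m) → v ⊖ 0⃗ ≡ v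
  ⊖-0⃗ []      = refl
  ⊖-0⃗ (x ∷ v) = cong₂ _∷_ (ℤ.+-identityʳ x) (⊖-0⃗ v)
... | tri> _ _ k<j  = subst (_∈ℕ⟨ simpleB k ⟩)
  (sym (trans (cong₂ _⊖_ (unit-beyond {suc k} {j} k<j) (unit-beyond {suc k} {suc j} (ℕ.m≤n⇒m≤1+n k<j))) (⊖-self 0⃗)))
  (0⃗∈ (simpleB k))

fromℕ<-mono-< : ∀ {m i j} (i<m : i < m) (j<m : j < m) → i < j → fromℕ< i<m Fin.< fromℕ< j<m
fromℕ<-mono-< i<m j<m = subst₂ _<_ (sym (Fin.toℕ-fromℕ< i<m)) (sym (Fin.toℕ-fromℕ< j<m))

private
  negative-positive : ∀ {m} (u v : ℤ^ m) → (0⃗ ⊖ u) ⊖ (0⃗ ⊖ v) ≡ ± Sign.+ · v ⊕ ± Sign.- · u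
  negative-positive []      []      = refl
  negative-positive (x ∷ u) (y ∷ v) = cong₂ _∷_
    (solve 2 (λ x y → (con 0ℤ :- x) :- (con 0ℤ :- y) := con 1ℤ :* y :+ con -1ℤ :* x) refl x y) (negative-positive u v)

  zero-positive : ∀ {m} (v : ℤ^ m) → (0⃗ ⊖ 0⃗) ⊖ (0⃗ ⊖ v) ≡ ± Sign.+ · v
  zero-positive []      = refl
  zero-positive (y ∷ v) = cong₂ _∷_
    (solve 1 (λ y → (con 0ℤ :- con 0ℤ) :- (con 0ℤ :- y) := con 1ℤ :* y) refl y) (zero-positive v)

  positive-positive : ∀ {m} (u v : ℤ^ m) → (u ⊖ 0⃗) ⊖ (0⃗ ⊖ v) ≡ ± Sign.+ · v ⊕ ± Sign.+ · u
  positive-positive []      []      = refl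
  positive-positive (x ∷ u) (y ∷ v) = cong₂ _∷_
    (solve 2 (λ x y → (x :- con 0ℤ) :- (con 0ℤ :- y) := con 1ℤ :* y :+ con 1ℤ :* x) refl x y) (positive-positive u v)

module TypeB (k : ℕ) where
  n = suc k
  S = simpleB k

  -- The chain -e₁, …, -eₙ, 0, eₙ, …, e₁, as unit j = 0⃗ for j ≥ n.
  E : ℕ → ℤ^ n
  E j = unit (n + n ∸ j) ⊖ unit j

  inRange? : Decidable (λ (p : ℕ²) → proj₁ p < proj₂ p × proj₁ p + proj₂ p < n + n)
  inRange? (i , j) = (i ℕ.<? j) ×-dec (i + j ℕ.<? n + n)

  U : List ℕ²
  U = filter inRange? (cartesianProduct (upTo (n + n)) (upTo (n + n)))

  open Chain {Φ = RootSystem.Φ (B n)} {S = S} E (n + n) U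

  ∈U⁻ : ∀ {i j} → (i , j) ∈ U → i < j × i + j < n + n
  ∈U⁻ p∈ = proj₂ (∈-filter⁻ inRange? {xs = cartesianProduct (upTo (n + n)) (upTo (n + n))} p∈)

  ∈U⁺ : ∀ {i j} → i < j → i + j < n + n → (i , j) ∈ U
  ∈U⁺ {i} {j} i<j i+j<2n = ∈-filter⁺ inRange? (∈-cartesianProduct⁺
    (∈-upTo⁺ (ℕ.≤-<-trans (ℕ.m≤m+n i j) i+j<2n)) (∈-upTo⁺ (ℕ.≤-<-trans (ℕ.m≤n+m j i) i+j<2n))) (i<j , i+j<2n)

  i<n : ∀ {i j} → i < j → i + j < n + n → i < n
  i<n {i} {j} i<j i+j<2n = ℕ.≰⇒> λ n≤i → ℕ.<⇒≱ i+j<2n (ℕ.+-mono-≤ n≤i (ℕ.≤-trans n≤i (ℕ.<⇒≤ i<j)))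

  j≤2n : ∀ {i j} → i + j < n + n → j ≤ n + n
  j≤2n {i} {j} i+j<2n = ℕ.≤-trans (ℕ.m≤n+m j i) (ℕ.<⇒≤ i+j<2n)

  i<2n∸j : ∀ {i j} → i + j < n + n → i < n + n ∸ j
  i<2n∸j {i} {j} i+j<2n = ℕ.m+n≤o⇒m≤o∸n (suc i) i+j<2n

  n≤2n∸ : ∀ {j} → j ≤ n → n ≤ n + n ∸ j
  n≤2n∸ {j} j≤n = ℕ.m+n≤o⇒m≤o∸n n (ℕ.+-monoʳ-≤ n j≤n)

  2n∸<n : ∀ {j} → n < j → n + n ∸ j < n
  2n∸<n {j} n<j with j ℕ.≤? n + n
  ... | yes j≤2n = ℕ.<-≤-trans (ℕ.∸-monoʳ-< n<j j≤2n) (ℕ.≤-reflexive (ℕ.m+n∸n≡m n n))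
  ... | no j≰2n  = subst (_< n) (sym (ℕ.m≤n⇒m∸n≡0 (ℕ.<⇒≤ (ℕ.≰⇒> j≰2n)))) (s≤s z≤n)

  E-low : ∀ {j} → j ≤ n → E j ≡ 0⃗ ⊖ unit j
  E-low {j} j≤n = cong (_⊖ unit j) (unit-beyond (n≤2n∸ j≤n))

  E-high : ∀ {j} → n ≤ j → E j ≡ unit (n + n ∸ j) ⊖ 0⃗
  E-high {j} n≤j = cong (unit (n + n ∸ j) ⊖_) (unit-beyond n≤j)

  E-middle : E n ≡ 0⃗ ⊖ 0⃗
  E-middle = trans (E-low ℕ.≤-refl) (cong (0⃗ ⊖_) (unit-beyond {n} {n} ℕ.≤-refl))

  root-difference : ∀ {i j} → i < n → j ≤ n → root (i , j) ≡ ± Sign.+ · unit i ⊕ ± Sign.- · unit j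
  root-difference {i} {j} i<n j≤n =
    trans (cong₂ _⊖_ (E-low j≤n) (E-low (ℕ.<⇒≤ i<n))) (negative-positive (unit j) (unit i))

  root-short : ∀ {i} → i < n → root (i , n) ≡ ± Sign.+ · unit i
  root-short {i} i<n = trans (cong₂ _⊖_ E-middle (E-low (ℕ.<⇒≤ i<n))) (zero-positive (unit i))

  root-sum : ∀ {i j} → i < n → n ≤ j → root (i , j) ≡ ± Sign.+ · unit i ⊕ ± Sign.+ · unit (n + n ∸ j)
  root-sum {i} {j} i<n n≤j =
    trans (cong₂ _⊖_ (E-high n≤j) (E-low (ℕ.<⇒≤ i<n))) (positive-positive (unit (n + n ∸ j)) (unit i))

  step : ∀ {j} → j < n + n → E (suc j) ⊖ E j ∈ℕ⟨ S ⟩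
  step {j} j<2n = subst (_∈ℕ⟨ S ⟩)
    (regroup (unit t) (unit (suc j)) (unit (suc t)) (unit j) (cong unit (ℕ.+-∸-assoc 1 j<2n)))
    (⊕-∈ S (unit-step-∈ k t) (unit-step-∈ k j))
    where
    t = n + n ∸ suc j
    regroup : ∀ (a b c d : ℤ^ n) {c′} → c′ ≡ c → (a ⊖ c) ⊕ (d ⊖ b) ≡ (a ⊖ b) ⊖ (c′ ⊖ d)
    regroup a b c d refl = sym (⊖-⊖-⊖ a b c d)

  prefix-root : ∀ {i j r} → i < n → r < n → prefix r ∙ root (i , j) ≡ (ind (n + n ∸ j) r -ℤ ind j r) +ℤ ind i r
  prefix-root {i} {j} {r} i<n r<n = begin
    prefix r ∙ root (i , j)                                         ≡⟨ ∙-⊖ (prefix r) (E j) (E i) ⟩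
    prefix r ∙ E j -ℤ prefix r ∙ E i                                ≡⟨ cong₂ _-ℤ_ (prefix-E j) (prefix-E i) ⟩
    (ind (n + n ∸ j) r -ℤ ind j r) -ℤ (ind (n + n ∸ i) r -ℤ ind i r)
      ≡⟨ cong (λ x → (ind (n + n ∸ j) r -ℤ ind j r) -ℤ (x -ℤ ind i r)) (ind-> (ℕ.<-≤-trans r<n (n≤2n∸ (ℕ.<⇒≤ i<n)))) ⟩
    (ind (n + n ∸ j) r -ℤ ind j r) -ℤ (0ℤ -ℤ ind i r)
      ≡⟨ solve 2 (λ x y → x :- (con 0ℤ :- y) := x :+ y) refl (ind (n + n ∸ j) r -ℤ ind j r) (ind i r) ⟩
    (ind (n + n ∸ j) r -ℤ ind j r) +ℤ ind i r                       ∎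
    where
    open ≡-Reasoning
    prefix-E : ∀ j → prefix r ∙ E j ≡ ind (n + n ∸ j) r -ℤ ind j r
    prefix-E j = trans (∙-⊖ {n} (prefix r) (unit (n + n ∸ j)) (unit j))
      (cong₂ _-ℤ_ (prefix-unit (n + n ∸ j) r<n) (prefix-unit j r<n))

  bounded : ∀ {i j} → (i , j) ∈ U → i ≤ j × j ≤ n + n
  bounded {i} {j} p∈ = let i<j , i+j<2n = ∈U⁻ p∈ in ℕ.<⇒≤ i<j , j≤2n {i} i+j<2n

  ∧-closed : ∀ {p q} → p ∈ U → q ∈ U → p ∧ q ∈ U
  ∧-closed {i , j} {k , l} p∈ q∈ = let i<j , i+j<2n = ∈U⁻ p∈ ; k<l , _ = ∈U⁻ q∈ in
    ∈U⁺ (ℕ.⊓-mono-< i<j k<l) (ℕ.≤-<-trans (ℕ.+-mono-≤ (ℕ.m⊓n≤m i k) (ℕ.m⊓n≤m j l)) i+j<2n)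

  isRoot : ∀ {p} → p ∈ U → RootSystem.Φ (B n) (root p)
  isRoot {i , j} p∈ with ∈U⁻ p∈
  ... | i<j , i+j<2n with i<n i<j i+j<2n | ℕ.<-cmp j n
  ...   | i<n | tri< j<n _ _  = inj₂
    ( fromℕ< i<n , fromℕ< j<n , Sign.+ , Sign.- , fromℕ<-mono-< i<n j<n i<j
    , trans (root-difference i<n (ℕ.<⇒≤ j<n))
        (cong₂ (λ u v → ± Sign.+ · u ⊕ ± Sign.- · v) (unit-fromℕ< i<n) (unit-fromℕ< j<n)) )
  ...   | i<n | tri≈ _ refl _ = inj₁
    ( fromℕ< i<n , Sign.+ , trans (root-short i<n) (cong (± Sign.+ ·_) (unit-fromℕ< i<n)) )
  ...   | i<n | tri> _ _ n<j  = inj₂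
    ( fromℕ< i<n , fromℕ< j′<n , Sign.+ , Sign.+ , fromℕ<-mono-< i<n j′<n (i<2n∸j {i} {j} i+j<2n)
    , trans (root-sum i<n (ℕ.<⇒≤ n<j))
        (cong₂ (λ u v → ± Sign.+ · u ⊕ ± Sign.+ · v) (unit-fromℕ< i<n) (unit-fromℕ< j′<n)) )
    where j′<n = 2n∸<n n<j

  complete : ∀ {v} → RootSystem.Φ (B n) v → v ∈ℕ⟨ S ⟩ → ∃ λ p → p ∈ U × v ≡ root p
  complete (inj₁ (i , Sign.+ , refl)) _ = (toℕ i , n)
    , ∈U⁺ (Fin.toℕ<n i) (ℕ.+-monoˡ-< n (Fin.toℕ<n i))
    , sym (trans (root-short (Fin.toℕ<n i)) (cong (± Sign.+ ·_) (unit-toℕ i)))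
  complete (inj₁ (i , Sign.- , refl)) v∈ =
    contradiction (subst (0ℤ ≤ℤ_) value (∙-nonneg {S = S} (prefix (toℕ i)) (prefix-simpleB (Fin.toℕ<n i)) v∈)) λ ()
    where
    value : prefix (toℕ i) ∙ (± Sign.- · e i) ≡ -1ℤ
    value = trans (∙-· -1ℤ (prefix (toℕ i)) (e i))
      (cong (-1ℤ *ℤ_) (trans (prefix-e i (Fin.toℕ<n i)) (ind-≤ {toℕ i} ℕ.≤-refl)))
  complete (inj₂ (i , j , Sign.- , t , i<j , refl)) v∈ =
    contradiction (subst (0ℤ ≤ℤ_) value (∙-nonneg {S = S} (prefix (toℕ i)) (prefix-simpleB (Fin.toℕ<n i)) v∈)) λ ()
    where
    w = prefix {n} (toℕ i)
    value : w ∙ (± Sign.- · e i ⊕ ± t · e j) ≡ -1ℤ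
    value = trans (∙-⊕ w (± Sign.- · e i) (± t · e j)) (cong₂ _+ℤ_
      (trans (∙-· -1ℤ w (e i)) (cong (-1ℤ *ℤ_) (trans (prefix-e i (Fin.toℕ<n i)) (ind-≤ {toℕ i} ℕ.≤-refl))))
      (trans (∙-· (± t) w (e j)) (trans (cong (± t *ℤ_) (trans (prefix-e j (Fin.toℕ<n i)) (ind-> i<j))) (±*0 t))))
  complete (inj₂ (i , j , Sign.+ , Sign.- , i<j , refl)) _ = (toℕ i , toℕ j)
    , ∈U⁺ i<j (ℕ.+-mono-< (Fin.toℕ<n i) (Fin.toℕ<n j))
    , sym (trans (root-difference (Fin.toℕ<n i) (ℕ.<⇒≤ (Fin.toℕ<n j)))
        (cong₂ (λ u v → ± Sign.+ · u ⊕ ± Sign.- · v) (unit-toℕ i) (unit-toℕ j)))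
  complete (inj₂ (i , j , Sign.+ , Sign.+ , i<j , refl)) _ = (toℕ i , n + n ∸ toℕ j)
    , ∈U⁺ (ℕ.<-≤-trans (Fin.toℕ<n i) n≤) (subst (toℕ i + (n + n ∸ toℕ j) <_) (ℕ.m+[n∸m]≡n j≤)
        (ℕ.+-monoˡ-< (n + n ∸ toℕ j) i<j))
    , sym (trans (root-sum (Fin.toℕ<n i) n≤)
        (cong₂ (λ u v → ± Sign.+ · u ⊕ ± Sign.+ · v) (unit-toℕ i)
          (trans (cong unit (ℕ.m∸[m∸n]≡n j≤)) (unit-toℕ j))))
    where
    j≤ : toℕ j ≤ n + n
    j≤ = ℕ.≤-trans (ℕ.<⇒≤ (Fin.toℕ<n j)) (ℕ.m≤m+n n n)
    n≤ : n ≤ n + n ∸ toℕ j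
    n≤ = n≤2n∸ (ℕ.<⇒≤ (Fin.toℕ<n j))

  reflects : ∀ {p q} → p ∈ U → q ∈ U → root q ⊖ root p ∈ℕ⟨ S ⟩ → p ⊑ q
  reflects {i , j} {h , l} p∈ q∈ d∈ with ∈U⁻ p∈ | ∈U⁻ q∈
  ... | i<j , i+j<2n | h<l , h+l<2n = ℕ.≮⇒≥ i≮h , ℕ.≮⇒≥ l≮j
    where
    value : ℕ → ℕ → ℕ → ℤ
    value i j r = (ind (n + n ∸ j) r -ℤ ind j r) +ℤ ind i r
    value-≡ : ∀ i j {r a b c} → ind (n + n ∸ j) r ≡ a → ind j r ≡ b → ind i r ≡ c → value i j r ≡ (a -ℤ b) +ℤ c
    value-≡ i j refl refl refl = refl
    compare : ∀ {r} → r < n → value i j r ≤ℤ value h l r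
    compare {r} r<n = ℤ.0≤i-j⇒j≤i (subst (0ℤ ≤ℤ_)
      (trans (∙-⊖ (prefix r) (root (h , l)) (root (i , j)))
        (cong₂ _-ℤ_ (prefix-root {h} {l} (i<n h<l h+l<2n) r<n) (prefix-root {i} {j} (i<n i<j i+j<2n) r<n)))
      (∙-nonneg {S = S} (prefix r) (prefix-simpleB r<n) d∈))
    i≮h : ¬ (i < h)
    i≮h i<h = 1≰0 (subst₂ _≤ℤ_
      (value-≡ i j (ind-> (i<2n∸j {i} {j} i+j<2n)) (ind-> i<j) (ind-≤ {i} ℕ.≤-refl))
      (value-≡ h l (ind-> (ℕ.<-trans i<h (i<2n∸j {h} {l} h+l<2n))) (ind-> (ℕ.<-trans i<h h<l)) (ind-> i<h))
      (compare (i<n i<j i+j<2n)))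
    l≮j : ¬ (l < j)
    l≮j l<j with j ℕ.≤? n
    l≮j (s≤s {n = r} l≤r) | yes j≤n = 1≰0 (ℤ.≤-trans
      (subst₂ _≤ℤ_
        (value-≡ i j (ind-> (ℕ.<-≤-trans j≤n (n≤2n∸ j≤n))) (ind-> {suc r} ℕ.≤-refl) (ind-≤ (ℕ.≤-pred i<j)))
        (value-≡ h l (ind-> (ℕ.<-≤-trans j≤n (n≤2n∸ (ℕ.≤-trans l≤r (ℕ.<⇒≤ j≤n))))) (ind-≤ l≤r) refl)
        (compare j≤n))
      (ℤ.+-monoʳ-≤ -1ℤ (ind≤1 h r)))
    ... | no j≰n = 2≰1 (ℤ.≤-trans
      (subst₂ _≤ℤ_
        (value-≡ i j (ind-≤ {r} ℕ.≤-refl) (ind-> (ℕ.<-trans r<n n<j)) (ind-≤ (ℕ.<⇒≤ (i<2n∸j {i} {j} i+j<2n))))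
        (value-≡ h l (ind-> (ℕ.∸-monoʳ-< l<j (j≤2n {i} i+j<2n))) refl refl)
        (compare r<n))
      (ℤ.+-mono-≤ (ℤ.i≤j⇒i-j≤0 (0≤ind l r)) (ind≤1 h r)))
      where
      r = n + n ∸ j
      n<j = ℕ.≰⇒> j≰n
      r<n = 2n∸<n n<j
      2≰1 : ¬ (+ 2 ≤ℤ 1ℤ)
      2≰1 (+≤+ (s≤s ()))

  B-suc-shellable : Shellable (antichains (B n))
  B-suc-shellable = chain-shellable step bounded ∧-closed isRoot complete reflects

B-shellable : ∀ n → 1 ≤ n → Shellable (antichains (B n))
B-shellable (suc k) _ = TypeB.B-suc-shellable k

theorem1p1 : ((∀ n → 1 ≤ n → Shellable (antichains (A n)))
    × (∀ n → 1 ≤ n → Shellable (antichains (B n)))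
    × Shellable (antichains (D 3))
    × Shellable (antichains G₂))
    × ((∀ n → 4 ≤ n → ¬ Shellable (antichains (D n)))
    × ¬ Shellable (antichains F₄)
    × ¬ Shellable (antichains E₆)
    × ¬ Shellable (antichains E₇)
    × ¬ Shellable (antichains E₈))
theorem1p1 =
    ((λ n _ → A-shellable n) , B-shellable , D₃-shellable , G₂-shellable)
  , (D-¬shellable , F₄-¬shellable , E₆-¬shellable , E₇-¬shellable , E₈-¬shellable)
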